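{- Consider the following system of polynomial equations in the noncommuting variables $x,x',y,y',z$: \[xx'=1,\quad yy'=1,\quad yx^2y'=x^3,\quad z\,(yxy'x'yx'y'x-1)=1.\] There exists a division ring in which this system has a solution, but for no field $\mathbb{F}$ and no positive integer $c$ does the system have a solution in $M_c(\mathbb{F})$ (where $1$ is interpreted as the identity matrix).
   Context: The division ring in question can be taken to be any division ring $D_{\mathrm{BS}}$ whose multiplicative group contains the Baumslag--Solitar group $\mathrm{BS}(2,3)=\langle a,b\mid ba^2b^{ -1}a^{ -3}\rangle$. -}

module Defs where

open import Level using (Level; _⊔_; suc)
open import Data.Nat using (ℕ; zero) renaming (suc to 1+)
open import Data.Fin using (Fin) renaming (zero to fz; suc to fs)
open import Data.Product using (Σ; ∃; _×_)
open import Relation.Nullary using (¬_)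
open import Algebra.Bundles using (Ring; CommutativeRing)

System : ∀ {a ℓ} {A : Set a} (_≈_ : A → A → Set ℓ) (_*_ _-_ : A → A → A)
         (1# : A) (x x' y y' z : A) → Set ℓ
System _≈_ _*_ _-_ 1# x x' y y' z =
  ((x * x') ≈ 1#) ×
  ((y * y') ≈ 1#) ×
  ((((y * x) * x) * y') ≈ ((x * x) * x)) ×
  ((z * ((((((((y * x) * y') * x') * y) * x') * y') * x) - 1#)) ≈ 1#)

HasSolution : ∀ {a ℓ} {A : Set a} (_≈_ : A → A → Set ℓ) (_*_ _-_ : A → A → A)
              (1# : A) → Set (a ⊔ ℓ)
HasSolution {A = A} _≈_ _*_ _-_ 1# =
  Σ A λ x → Σ A λ x' → Σ A λ y → Σ A λ y' → Σ A λ z →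
    System _≈_ _*_ _-_ 1# x x' y y' z

record DivisionRing (c ℓ : Level) : Set (suc (c ⊔ ℓ)) where
  field
    ring : Ring c ℓ
  open Ring ring public
  field
    1≉0     : ¬ (1# ≈ 0#)
    inverse : ∀ u → ¬ (u ≈ 0#) → ∃ λ v → ((u * v) ≈ 1#) × ((v * u) ≈ 1#)

record Field (c ℓ : Level) : Set (suc (c ⊔ ℓ)) where
  field
    commutativeRing : CommutativeRing c ℓ
  open CommutativeRing commutativeRing public
  field
    1≉0     : ¬ (1# ≈ 0#)
    inverse : ∀ u → ¬ (u ≈ 0#) → ∃ λ v → ((u * v) ≈ 1#) × ((v * u) ≈ 1#)

module Matrices {c ℓ : Level} (F : Field c ℓ) where
  open Field F

  Mat : ℕ → Set c
  Mat n = Fin n → Fin n → Carrier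

  Σᶠ : ∀ {n} → (Fin n → Carrier) → Carrier
  Σᶠ {zero}  f = 0#
  Σᶠ {1+ n}  f = f fz + Σᶠ (λ i → f (fs i))

  _≈ᴹ_ : ∀ {n} → Mat n → Mat n → Set ℓ
  A ≈ᴹ B = ∀ i j → A i j ≈ B i j

  _*ᴹ_ : ∀ {n} → Mat n → Mat n → Mat n
  (A *ᴹ B) i j = Σᶠ (λ k → A i k * B k j)

  _-ᴹ_ : ∀ {n} → Mat n → Mat n → Mat n
  (A -ᴹ B) i j = A i j - B i j

  δ : ∀ {n} → Fin n → Fin n → Carrier
  δ fz     fz     = 1#
  δ fz     (fs j) = 0#
  δ (fs i) fz     = 0#
  δ (fs i) (fs j) = δ i j

  1ᴹ : ∀ {n} → Mat n
  1ᴹ = δ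

HasMatrixSolution : ∀ {c ℓ} → Field c ℓ → ℕ → Set (c ⊔ ℓ)
HasMatrixSolution F n = HasSolution (_≈ᴹ_ {n}) _*ᴹ_ _-ᴹ_ 1ᴹ
  where open Matrices F

HasDivisionRingSolution : ∀ {c ℓ} → DivisionRing c ℓ → Set (c ⊔ ℓ)
HasDivisionRingSolution D = HasSolution _≈_ _*_ _-_ 1#
  where open DivisionRing D

{-# OPTIONS --safe #-}

-- Division ring.  Let M be the monoid of products X^ψ vʳ pⁱ qʲ with ψ : ℕ → ℕ periodic,
-- X^ψ X^χ = X^(ψ+χ), p v = v² p, q v = v³ q and p q = q p, where v, p and q act on the periodic
-- functions by translation and dilation.  M has a right-invariant total order and is left
-- cancellative, so 𝔽₂[M] is a domain; M has boxes S with |S X| < 2 |S| for every finite X, so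
-- by the pigeonhole principle 𝔽₂[M] satisfies the left Ore condition.  In its division ring
-- of fractions put x = v² and y = g p⁻¹ q, where g = X^ψ for ψ the indicator function of the
-- multiples of 6.  Then p⁻¹ q conjugates v² to v³, so y x y⁻¹ = g v³ g⁻¹, whose square is v⁶ = x³
-- because g commutes with v⁶; but g v³ g⁻¹ does not commute with v².
--
-- Matrices.  The powers x, x², x⁴, x⁸, … are linearly dependent, so some x^(2ⁱ) is a
-- combination of the x^(2ʲ) with j > i.  Conjugating i + 1 times by y shows that
-- y x^(3ⁱ) y⁻¹ is a combination of powers of x, hence that y x y⁻¹ commutes with x, and
-- then y x y⁻¹ x⁻¹ y x⁻¹ y⁻¹ x - 1 = 0 is not invertible.

module Submission where

open import Defs
open import Level using (Level; 0ℓ)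
open import Data.Nat using (ℕ; suc)
open import Data.Product using (Σ; _×_)
open import Relation.Nullary using (¬_)

-- The group BS(2,3) contains free subgroups of rank two, so its own group ring fails the Ore
-- condition. The equations ask for less than a copy of it: a pair satisfying the relation for which
-- y x y⁻¹ and x do not commute. This leaves room for a substitute built from commutative layers,
-- which has Følner sets. Translations and dilations alone are too small: for x = v² and y = p⁻¹ q
-- the conjugate v³ still commutes with x. The factor g repairs this; its period 6 is the least
-- common multiple of 2 and 3, so that neither translation by 2 nor translation by 3 fixes it while
-- translation by 6 does. Natural exponents suffice in M, since inverses first appear in the
-- fractions. The price is that the order on M is invariant on one side only and that a translation
-- of ℕ forgets initial values. For matrices, equality in the field is not decidable, so linear
-- dependence is obtained only under a double negation; the goal is a negation, so this is enough.
-- The equations give one-sided inverses, and the other sides come from the same dependence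
-- principle.

module OreLocalisation where

  open import Level using (Level; _⊔_)
  open import Data.Product using (∃; ∃₂; _×_; _,_)
  open import Data.Sum using (_⊎_; inj₁; inj₂)
  open import Data.Empty using (⊥-elim)
  open import Algebra.Bundles using (Ring)
  import Algebra.Properties.Ring as RingProperties
  import Relation.Binary.Reasoning.Setoid as SetoidReasoning

  -- Left Ore localisation of a domain.

  module _ {c ℓ : Level} (R : Ring c ℓ) where

    open Ring R

    module Fractions (1≉0 : ¬ (1# ≈ 0#))
      (integral : ∀ a b → a * b ≈ 0# → a ≈ 0# ⊎ b ≈ 0#)
      (ore : ∀ a b → ¬ (b ≈ 0#) → ∃₂ λ r s → ¬ (r ≈ 0#) × r * a ≈ s * b) where

      open RingProperties R using (-‿distribʳ-*; x∙y⁻¹≈ε⇒x≈y; x≈y⇒x∙y⁻¹≈ε; [y-z]x≈yx-zx; x[y-z]≈xy-xz)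
      open SetoidReasoning setoid

      *-≉0 : ∀ {a b} → ¬ (a ≈ 0#) → ¬ (b ≈ 0#) → ¬ (a * b ≈ 0#)
      *-≉0 {a} {b} a≉0 b≉0 ab≈0 with integral a b ab≈0
      ... | inj₁ a≈0 = a≉0 a≈0
      ... | inj₂ b≈0 = b≉0 b≈0

      *-cancelˡ : ∀ {a b d} → ¬ (d ≈ 0#) → d * a ≈ d * b → a ≈ b
      *-cancelˡ {a} {b} {d} d≉0 eq
        with integral d (a - b) (trans (x[y-z]≈xy-xz d a b) (x≈y⇒x∙y⁻¹≈ε eq))
      ... | inj₁ d≈0   = ⊥-elim (d≉0 d≈0)
      ... | inj₂ a-b≈0 = x∙y⁻¹≈ε⇒x≈y a b a-b≈0

      *-cancelʳ : ∀ {a b d} → ¬ (d ≈ 0#) → a * d ≈ b * d → a ≈ b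
      *-cancelʳ {a} {b} {d} d≉0 eq
        with integral (a - b) d (trans ([y-z]x≈yx-zx d a b) (x≈y⇒x∙y⁻¹≈ε eq))
      ... | inj₁ a-b≈0 = x∙y⁻¹≈ε⇒x≈y a b a-b≈0
      ... | inj₂ d≈0   = ⊥-elim (d≉0 d≈0)

      record Fraction : Set (c ⊔ ℓ) where
        constructor frac
        field
          den   : Carrier
          num   : Carrier
          den≉0 : ¬ (den ≈ 0#)
      open Fraction

      -- q ∶ u ↦ w says that u q = w, where q stands for den⁻¹ num.  A fraction is
      -- thus a partially defined left-linear map, and every ring law is
      -- checked by following a single nonzero u on which both sides are defined.
      infix 4 _∶_↦_
      _∶_↦_ : Fraction → Carrier → Carrier → Set (c ⊔ ℓ)
      q ∶ u ↦ w = ∃₂ λ d r → ¬ (d ≈ 0#) × (d * u ≈ r * den q) × (d * w ≈ r * num q)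

      ↦-multiple : ∀ q {u w} r → u ≈ r * den q → w ≈ r * num q → q ∶ u ↦ w
      ↦-multiple q r p p′ =
        1# , r , 1≉0 , trans (*-identityˡ _) p , trans (*-identityˡ _) p′

      ↦-den : ∀ q → q ∶ den q ↦ num q
      ↦-den q = ↦-multiple q 1# (sym (*-identityˡ _)) (sym (*-identityˡ _))

      ↦-resp : ∀ q {u u′ w w′} → u ≈ u′ → w ≈ w′ → q ∶ u ↦ w → q ∶ u′ ↦ w′
      ↦-resp q p p′ (d , r , d≉0 , e , e′) =
        d , r , d≉0 , trans (*-congˡ (sym p)) e , trans (*-congˡ (sym p′)) e′

      ↦-scale : ∀ q e {u w} → q ∶ u ↦ w → q ∶ e * u ↦ e * w
      ↦-scale q e {u} {w} (d , r , d≉0 , p , p′) with ore e d d≉0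
      ... | a , b , a≉0 , ae≈bd = a , b * r , a≉0 , lift p , lift p′
        where
        lift : ∀ {x y} → d * x ≈ r * y → a * (e * x) ≈ b * r * y
        lift {x} {y} eq = begin
          a * (e * x) ≈⟨ *-assoc a e x ⟨
          a * e * x   ≈⟨ *-congʳ ae≈bd ⟩
          b * d * x   ≈⟨ *-assoc b d x ⟩
          b * (d * x) ≈⟨ *-congˡ eq ⟩
          b * (r * y) ≈⟨ *-assoc b r y ⟨
          b * r * y   ∎

      -- This is what the factor `d` in `_∶_↦_` is for: without it `q` would be defined only on left
      -- multiples of its denominator, and the domain would change with the representation of the
      -- fraction.
      ↦-unscale : ∀ q {e u w} → ¬ (e ≈ 0#) → q ∶ e * u ↦ e * w → q ∶ u ↦ w
      ↦-unscale q {e} e≉0 (d , r , d≉0 , p , p′) =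
        d * e , r , *-≉0 d≉0 e≉0 , trans (*-assoc d e _) p , trans (*-assoc d e _) p′

      -- A common left multiple of `d` and `d′` puts both witnesses over the same scalar; cancelling
      -- `den q` on the right then identifies the two multiples of `num q`.
      ↦-functional : ∀ q {u w w′} → q ∶ u ↦ w → q ∶ u ↦ w′ → w ≈ w′
      ↦-functional q {u} {w} {w′} (d , r , d≉0 , p , s) (d′ , r′ , d′≉0 , p′ , s′)
        with ore d d′ d′≉0
      ... | a , b , a≉0 , ad≈bd′ = *-cancelˡ (*-≉0 a≉0 d≉0) (begin
          a * d * w       ≈⟨ *-assoc a d w ⟩
          a * (d * w)     ≈⟨ *-congˡ s ⟩
          a * (r * num q) ≈⟨ *-assoc a r _ ⟨
          a * r * num q   ≈⟨ *-congʳ ar≈br′ ⟩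
          b * r′ * num q  ≈⟨ *-assoc b r′ _ ⟩
          b * (r′ * num q) ≈⟨ *-congˡ s′ ⟨
          b * (d′ * w′)   ≈⟨ *-assoc b d′ w′ ⟨
          b * d′ * w′     ≈⟨ *-congʳ ad≈bd′ ⟨
          a * d * w′      ∎)
        where
        ar≈br′ : a * r ≈ b * r′
        ar≈br′ = *-cancelʳ (den≉0 q) (begin
          a * r * den q    ≈⟨ *-assoc a r _ ⟩
          a * (r * den q)  ≈⟨ *-congˡ p ⟨
          a * (d * u)      ≈⟨ *-assoc a d u ⟨
          a * d * u        ≈⟨ *-congʳ ad≈bd′ ⟩
          b * d′ * u       ≈⟨ *-assoc b d′ u ⟩
          b * (d′ * u)     ≈⟨ *-congˡ p′ ⟩
          b * (r′ * den q) ≈⟨ *-assoc b r′ _ ⟨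
          b * r′ * den q   ∎)

      ↦-functional′ : ∀ q {u u′ w w′} → u ≈ u′ → q ∶ u ↦ w → q ∶ u′ ↦ w′ → w ≈ w′
      ↦-functional′ q u≈u′ h h′ = ↦-functional q (↦-resp q u≈u′ refl h) h′

      -- The domain of a fraction meets the left multiples of every element. Applied to several
      -- fractions in turn, this produces the common nonzero starting point at which a ring law is
      -- checked.
      ↦-total : ∀ q u → ∃₂ λ e w → ¬ (e ≈ 0#) × (q ∶ e * u ↦ w)
      ↦-total q u with ore u (den q) (den≉0 q)
      ... | a , b , a≉0 , eq = a , b * num q , a≉0 , ↦-multiple q b eq refl

      ↦-+ : ∀ q {u w u′ w′} → q ∶ u ↦ w → q ∶ u′ ↦ w′ → q ∶ u + u′ ↦ w + w′
      ↦-+ q {u} {w} {u′} {w′} (d , r , d≉0 , p , s) (d′ , r′ , d′≉0 , p′ , s′)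
        with ore d d′ d′≉0
      ... | a , b , a≉0 , ad≈bd′ =
        a * d , a * r + b * r′ , *-≉0 a≉0 d≉0 , add p p′ , add s s′
        where
        add : ∀ {x y z} → d * x ≈ r * z → d′ * y ≈ r′ * z →
              a * d * (x + y) ≈ (a * r + b * r′) * z
        add {x} {y} {z} e e′ = begin
          a * d * (x + y)             ≈⟨ distribˡ (a * d) x y ⟩
          a * d * x + a * d * y       ≈⟨ +-congˡ (*-congʳ ad≈bd′) ⟩
          a * d * x + b * d′ * y      ≈⟨ +-cong (*-assoc a d x) (*-assoc b d′ y) ⟩
          a * (d * x) + b * (d′ * y)  ≈⟨ +-cong (*-congˡ e) (*-congˡ e′) ⟩
          a * (r * z) + b * (r′ * z)  ≈⟨ +-cong (*-assoc a r z) (*-assoc b r′ z) ⟨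
          a * r * z + b * r′ * z      ≈⟨ distribʳ z (a * r) (b * r′) ⟨
          (a * r + b * r′) * z        ∎

      infix 4 _≋_
      _≋_ : Fraction → Fraction → Set (c ⊔ ℓ)
      q ≋ q′ = ∃₂ λ u w → ¬ (u ≈ 0#) × (q ∶ u ↦ w) × (q′ ∶ u ↦ w)

      -- Agreement at a single nonzero `u₀` is enough: `u` and `u₀` have a common left multiple with
      -- nonzero cofactor `a` on `u`, and the value at `u` is recovered from the value at `a * u`.
      ≋-transport : ∀ q q′ → q ≋ q′ → ∀ {u w} → q ∶ u ↦ w → q′ ∶ u ↦ w
      ≋-transport q q′ (u₀ , w₀ , u₀≉0 , h , h′) {u} {w} k with ore u u₀ u₀≉0
      ... | a , b , a≉0 , au≈bu₀ =
        ↦-unscale q′ a≉0 (↦-resp q′ (sym au≈bu₀)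
          (sym (↦-functional′ q au≈bu₀ (↦-scale q a k) (↦-scale q b h)))
          (↦-scale q′ b h′))

      ≋-refl : ∀ {q} → q ≋ q
      ≋-refl {q} = den q , num q , den≉0 q , ↦-den q , ↦-den q

      ≋-sym : ∀ {q q′} → q ≋ q′ → q′ ≋ q
      ≋-sym (u , w , u≉0 , h , h′) = u , w , u≉0 , h′ , h

      ≋-trans : ∀ {q q′ q″} → q ≋ q′ → q′ ≋ q″ → q ≋ q″
      ≋-trans {q} {q′} {q″} (u , w , u≉0 , h , h′) e =
        u , w , u≉0 , h , ≋-transport q′ q″ e h′

      infixl 6 _⊕_
      infixl 7 _⊛_

      _⊕_ : Fraction → Fraction → Fraction
      q ⊕ q′ with ore (den q) (den q′) (den≉0 q′)
      ... | a , b , a≉0 , _ =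
        frac (a * den q) (a * num q + b * num q′) (*-≉0 a≉0 (den≉0 q))

      -- The Ore condition rewrites `num q` times the inverse of `den q′` as a⁻¹ b.
      _⊛_ : Fraction → Fraction → Fraction
      q ⊛ q′ with ore (num q) (den q′) (den≉0 q′)
      ... | a , b , a≉0 , _ = frac (a * den q) (b * num q′) (*-≉0 a≉0 (den≉0 q))

      ⊖_ : Fraction → Fraction
      ⊖ q = frac (den q) (- num q) (den≉0 q)

      embed : Carrier → Fraction
      embed a = frac 1# a 1≉0

      ↦-⊕ : ∀ q q′ {u w w′} → q ∶ u ↦ w → q′ ∶ u ↦ w′ → q ⊕ q′ ∶ u ↦ w + w′
      ↦-⊕ q q′ {u} {w} {w′} h h′ with ore (den q) (den q′) (den≉0 q′)
      ... | a , b , a≉0 , ab≈bb′ with ore u (a * den q) (*-≉0 a≉0 (den≉0 q))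
      ...   | e , f , e≉0 , eu≈f = e , f , e≉0 , eu≈f , (begin
          e * (w + w′)                            ≈⟨ distribˡ e w w′ ⟩
          e * w + e * w′                          ≈⟨ +-cong
            (↦-functional′ q eu≈f (↦-scale q e h) (↦-scale q f (↦-scale q a (↦-den q))))
            (↦-functional′ q′ (trans eu≈f (*-congˡ ab≈bb′)) (↦-scale q′ e h′)
                              (↦-scale q′ f (↦-scale q′ b (↦-den q′)))) ⟩
          f * (a * num q) + f * (b * num q′)      ≈⟨ distribˡ f _ _ ⟨
          f * (a * num q + b * num q′)            ∎)

      ↦-⊛ : ∀ q q′ {u w z} → q ∶ u ↦ w → q′ ∶ w ↦ z → q ⊛ q′ ∶ u ↦ z
      ↦-⊛ q q′ {u} {w} {z} h h′ with ore (num q) (den q′) (den≉0 q′)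
      ... | a , b , a≉0 , aa≈bb′ with ore u (a * den q) (*-≉0 a≉0 (den≉0 q))
      ...   | e , f , e≉0 , eu≈f = e , f , e≉0 , eu≈f ,
          ↦-functional′ q′ (trans ew≈ (*-congˡ aa≈bb′))
            (↦-scale q′ e h′) (↦-scale q′ f (↦-scale q′ b (↦-den q′)))
        where
        ew≈ : e * w ≈ f * (a * num q)
        ew≈ = ↦-functional′ q eu≈f (↦-scale q e h) (↦-scale q f (↦-scale q a (↦-den q)))

      ↦-⊖ : ∀ q {u w} → q ∶ u ↦ w → ⊖ q ∶ u ↦ - w
      ↦-⊖ q {u} {w} (d , r , d≉0 , p , s) = d , r , d≉0 , p , (begin
        d * - w       ≈⟨ -‿distribʳ-* d w ⟨
        - (d * w)     ≈⟨ -‿cong s ⟩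
        - (r * num q) ≈⟨ -‿distribʳ-* r (num q) ⟩
        r * - num q   ∎)

      ↦-embed : ∀ a u → embed a ∶ u ↦ u * a
      ↦-embed a u = ↦-multiple (embed a) u (sym (*-identityʳ u)) refl

      ↦-0 : ∀ u → embed 0# ∶ u ↦ 0#
      ↦-0 u = ↦-resp (embed 0#) refl (zeroʳ u) (↦-embed 0# u)

      ↦-1 : ∀ u → embed 1# ∶ u ↦ u
      ↦-1 u = ↦-resp (embed 1#) refl (*-identityʳ u) (↦-embed 1# u)

      private
        Defined₂ Path₂ : Fraction → Fraction → Set (c ⊔ ℓ)
        Defined₂ q q′ = ∃ λ u → ¬ (u ≈ 0#) × ∃ (q ∶ u ↦_) × ∃ (q′ ∶ u ↦_)
        Path₂ q q′ = ∃ λ u → ¬ (u ≈ 0#) × ∃ λ w → (q ∶ u ↦ w) × ∃ (q′ ∶ w ↦_)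

        defined₂ : ∀ q q′ → Defined₂ q q′
        defined₂ q q′ with ↦-total q′ (den q)
        ... | e , w , e≉0 , h =
          e * den q , *-≉0 e≉0 (den≉0 q) , (_ , ↦-scale q e (↦-den q)) , (w , h)

        path₂ : ∀ q q′ → Path₂ q q′
        path₂ q q′ with ↦-total q′ (num q)
        ... | e , w , e≉0 , h =
          e * den q , *-≉0 e≉0 (den≉0 q) , _ , ↦-scale q e (↦-den q) , (w , h)

      ⊕-cong : ∀ {q r q′ r′} → q ≋ r → q′ ≋ r′ → q ⊕ q′ ≋ r ⊕ r′
      ⊕-cong {q} {r} {q′} {r′} e e′ with defined₂ q q′
      ... | u , u≉0 , (w , h) , (w′ , h′) = u , w + w′ , u≉0 , ↦-⊕ q q′ h h′ ,
        ↦-⊕ r r′ (≋-transport q r e h) (≋-transport q′ r′ e′ h′)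

      ⊛-cong : ∀ {q r q′ r′} → q ≋ r → q′ ≋ r′ → q ⊛ q′ ≋ r ⊛ r′
      ⊛-cong {q} {r} {q′} {r′} e e′ with path₂ q q′
      ... | u , u≉0 , w , h , (z , h′) = u , z , u≉0 , ↦-⊛ q q′ h h′ ,
        ↦-⊛ r r′ (≋-transport q r e h) (≋-transport q′ r′ e′ h′)

      ⊖-cong : ∀ {q r} → q ≋ r → ⊖ q ≋ ⊖ r
      ⊖-cong {q} {r} (u , w , u≉0 , h , h′) = u , - w , u≉0 , ↦-⊖ q h , ↦-⊖ r h′

      ⊕-comm : ∀ q r → q ⊕ r ≋ r ⊕ q
      ⊕-comm q r with defined₂ q r
      ... | u , u≉0 , (w , h) , (w′ , h′) = u , w + w′ , u≉0 , ↦-⊕ q r h h′ ,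
        ↦-resp (r ⊕ q) refl (+-comm w′ w) (↦-⊕ r q h′ h)

      ⊕-assoc : ∀ q r s → (q ⊕ r) ⊕ s ≋ q ⊕ (r ⊕ s)
      ⊕-assoc q r s with defined₂ q r
      ... | u , u≉0 , (w , h) , (w′ , h′) with ↦-total s u
      ...   | e , z , e≉0 , k = e * u , _ , *-≉0 e≉0 u≉0 ,
        ↦-⊕ (q ⊕ r) s (↦-⊕ q r eh eh′) k ,
        ↦-resp (q ⊕ (r ⊕ s)) refl (sym (+-assoc _ _ _)) (↦-⊕ q (r ⊕ s) eh (↦-⊕ r s eh′ k))
        where
        eh  = ↦-scale q e h
        eh′ = ↦-scale r e h′

      ⊕-identityˡ : ∀ q → embed 0# ⊕ q ≋ q
      ⊕-identityˡ q = den q , num q , den≉0 q ,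
        ↦-resp (embed 0# ⊕ q) refl (+-identityˡ _) (↦-⊕ (embed 0#) q (↦-0 _) (↦-den q)) , ↦-den q

      ⊕-inverseˡ : ∀ q → (⊖ q) ⊕ q ≋ embed 0#
      ⊕-inverseˡ q = den q , 0# , den≉0 q ,
        ↦-resp ((⊖ q) ⊕ q) refl (-‿inverseˡ _) (↦-⊕ (⊖ q) q (↦-⊖ q (↦-den q)) (↦-den q)) , ↦-0 _

      ⊛-assoc : ∀ q r s → (q ⊛ r) ⊛ s ≋ q ⊛ (r ⊛ s)
      ⊛-assoc q r s with path₂ q r
      ... | u , u≉0 , w , h , (w′ , h′) with ↦-total s w′
      ...   | e , z , e≉0 , k = e * u , z , *-≉0 e≉0 u≉0 ,
        ↦-⊛ (q ⊛ r) s (↦-⊛ q r eh eh′) k , ↦-⊛ q (r ⊛ s) eh (↦-⊛ r s eh′ k)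
        where
        eh  = ↦-scale q e h
        eh′ = ↦-scale r e h′

      ⊛-identityˡ : ∀ q → embed 1# ⊛ q ≋ q
      ⊛-identityˡ q = den q , num q , den≉0 q , ↦-⊛ (embed 1#) q (↦-1 _) (↦-den q) , ↦-den q

      ⊛-identityʳ : ∀ q → q ⊛ embed 1# ≋ q
      ⊛-identityʳ q = den q , num q , den≉0 q , ↦-⊛ q (embed 1#) (↦-den q) (↦-1 _) , ↦-den q

      ⊛-distribˡ : ∀ q r s → q ⊛ (r ⊕ s) ≋ (q ⊛ r) ⊕ (q ⊛ s)
      ⊛-distribˡ q r s with path₂ q r
      ... | u , u≉0 , w , h , (w′ , h′) with ↦-total s w
      ...   | e , z , e≉0 , k = e * u , _ , *-≉0 e≉0 u≉0 ,
        ↦-⊛ q (r ⊕ s) eh (↦-⊕ r s eh′ k) ,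
        ↦-⊕ (q ⊛ r) (q ⊛ s) (↦-⊛ q r eh eh′) (↦-⊛ q s eh k)
        where
        eh  = ↦-scale q e h
        eh′ = ↦-scale r e h′

      -- Here `q` has to be defined at both values `w` and `w′`, hence two successive scalings, by
      -- `e` and then by `f`.
      ⊛-distribʳ : ∀ q r s → (r ⊕ s) ⊛ q ≋ (r ⊛ q) ⊕ (s ⊛ q)
      ⊛-distribʳ q r s with defined₂ r s
      ... | u , u≉0 , (w , h) , (w′ , h′) with ↦-total q w
      ...   | e , z , e≉0 , k with ↦-total q (e * w′)
      ...     | f , z′ , f≉0 , k′ = f * (e * u) , _ , *-≉0 f≉0 (*-≉0 e≉0 u≉0) ,
        ↦-⊛ (r ⊕ s) q (↦-⊕ r s feh feh′) (↦-+ q fk k′) ,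
        ↦-⊕ (r ⊛ q) (s ⊛ q) (↦-⊛ r q feh fk) (↦-⊛ s q feh′ k′)
        where
        feh  = ↦-scale r f (↦-scale r e h)
        feh′ = ↦-scale s f (↦-scale s e h′)
        fk   = ↦-scale q f k

      fractionRing : Ring (c ⊔ ℓ) (c ⊔ ℓ)
      fractionRing = record
        { Carrier = Fraction ; _≈_ = _≋_ ; _+_ = _⊕_ ; _*_ = _⊛_ ; -_ = ⊖_
        ; 0# = embed 0# ; 1# = embed 1#
        ; isRing = record
          { +-isAbelianGroup = record
            { isGroup = record
              { isMonoid = record
                { isSemigroup = record
                  { isMagma = record
                    { isEquivalence = record
                      { refl  = λ {q} → ≋-refl {q}
                      ; sym   = λ {q} {r} → ≋-sym {q} {r}
                      ; trans = λ {q} {r} {s} → ≋-trans {q} {r} {s}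
                      }
                    ; ∙-cong = λ {q} {r} {q′} {r′} → ⊕-cong {q} {r} {q′} {r′}
                    }
                  ; assoc = ⊕-assoc
                  }
                ; identity = ⊕-identityˡ , λ q →
                    ≋-trans {q ⊕ embed 0#} {embed 0# ⊕ q} {q} (⊕-comm q (embed 0#)) (⊕-identityˡ q)
                }
              ; inverse = ⊕-inverseˡ , λ q →
                  ≋-trans {q ⊕ (⊖ q)} {(⊖ q) ⊕ q} {embed 0#} (⊕-comm q (⊖ q)) (⊕-inverseˡ q)
              ; ⁻¹-cong = λ {q} {r} → ⊖-cong {q} {r}
              }
            ; comm = ⊕-comm
            }
          ; *-cong = λ {q} {r} {q′} {r′} → ⊛-cong {q} {r} {q′} {r′}
          ; *-assoc = ⊛-assoc
          ; *-identity = ⊛-identityˡ , ⊛-identityʳ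
          ; distrib = ⊛-distribˡ , ⊛-distribʳ
          }
        }

      ≋0⇒↦0 : ∀ q → q ≋ embed 0# → ∀ {u w} → q ∶ u ↦ w → w ≈ 0#
      ≋0⇒↦0 q e {u} h = ↦-functional (embed 0#) (≋-transport q (embed 0#) e h) (↦-0 u)

      num≉0 : ∀ q → ¬ (q ≋ embed 0#) → ¬ (num q ≈ 0#)
      num≉0 q q≉0 n≈0 =
        q≉0 (den q , 0# , den≉0 q , ↦-resp q refl n≈0 (↦-den q) , ↦-0 _)

      ⊛-inverse : ∀ q (n≉0 : ¬ (num q ≈ 0#)) → q ⊛ frac (num q) (den q) n≉0 ≋ embed 1#
      ⊛-inverse q n≉0 = den q , den q , den≉0 q ,
        ↦-⊛ q q⁻¹ (↦-den q) (↦-den q⁻¹) , ↦-1 _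
        where q⁻¹ = frac (num q) (den q) n≉0

      fractionDivisionRing : DivisionRing (c ⊔ ℓ) (c ⊔ ℓ)
      fractionDivisionRing = record
        { ring    = fractionRing
        ; 1≉0     = λ e → 1≉0 (≋0⇒↦0 (embed 1#) e (↦-1 1#))
        ; inverse = λ q q≉0 → let n≉0 = num≉0 q q≉0 in
            frac (num q) (den q) n≉0 ,
            ⊛-inverse q n≉0 ,
            ⊛-inverse (frac (num q) (den q) n≉0) (den≉0 q)
        }

-- The monoid ring over 𝔽₂: zero divisors and the Ore condition.

module MonoidRings where

  open import Level using (Level; _⊔_)
  open import Algebra.Bundles using (Monoid; Ring)
  import Algebra.Properties.Ring as RingProperties
  open import Data.Bool using (Bool; true; false; _∧_; _xor_; if_then_else_)
  open import Data.Bool.Properties using (xor-assoc; xor-comm; xor-same; xor-identityʳ; ∧-distribʳ-xor; ∧-identityʳ; ∧-zeroʳ)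
  open import Data.Fin using (Fin; zero; suc; _↑ˡ_; _↑ʳ_; splitAt; combine; finToFun; funToFin)
  open import Data.Fin.Properties using (pigeonhole; join-splitAt; finToFun-funToFin; funToFin-finToFin; suc-injective) renaming (<⇒≢ to <ᶠ⇒≢)
  open import Data.List using (List; []; _∷_; _++_; map; cartesianProductWith)
  open import Data.List.Relation.Unary.All using (All; []; _∷_)
  import Data.List.Relation.Unary.All as All
  import Data.List.Relation.Unary.All.Properties as All
  open import Data.List.Relation.Unary.AllPairs using (AllPairs; []; _∷_)
  open import Data.Nat using (zero; suc; _+_; _^_; _<_; s≤s; z≤n)
  open import Data.Nat.Properties using (^-monoʳ-<)
  open import Data.Product using (Σ; ∃; ∃₂; _×_; _,_)
  open import Data.Sum using (_⊎_; inj₁; inj₂)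
  open import Function using (_∘_; id)
  open import Relation.Binary.PropositionalEquality as ≡ using (_≡_; _≗_; cong; cong₂; module ≡-Reasoning)
  open import Relation.Nullary using (¬_; Dec; yes; no; does; contradiction)
  open import Relation.Nullary.Decidable using (dec-true; dec-false)

  funToFin-cong : ∀ {m n} {f g : Fin m → Fin n} → f ≗ g → funToFin f ≡ funToFin g
  funToFin-cong {zero}  h = ≡.refl
  funToFin-cong {suc m} h = cong₂ combine (h zero) (funToFin-cong (h ∘ suc))

  finToFun-injective : ∀ {m n} {i j : Fin (m ^ n)} → finToFun {m} {n} i ≗ finToFun j → i ≡ j
  finToFun-injective {m} {n} {i} {j} h =
    ≡.trans (≡.sym (funToFin-finToFin {n} {m} i)) (≡.trans (funToFin-cong h) (funToFin-finToFin {n} {m} j))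

  bit : Fin 2 → Bool
  bit zero    = false
  bit (suc _) = true

  unbit : Bool → Fin 2
  unbit false = zero
  unbit true  = suc zero

  bit-xor : ∀ i j → bit i xor bit j ≡ false → i ≡ j
  bit-xor zero       zero       _ = ≡.refl
  bit-xor (suc zero) (suc zero) _ = ≡.refl

  unbit-xor : ∀ {p q} → unbit p ≡ unbit q → p xor q ≡ false
  unbit-xor {false} {false} _ = ≡.refl
  unbit-xor {true}  {true}  _ = ≡.refl

  module MonoidRing {a ℓ : Level} (M : Monoid a ℓ) where

    open Monoid M

    Respects : (Carrier → Bool) → Set (a ⊔ ℓ)
    Respects φ = ∀ {x y} → x ≈ y → φ x ≡ φ y

    -- The linear extension of `φ` to formal sums. Testing equality against such functionals gives
    -- the ring laws for every monoid, without deciding equality of its elements.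
    ∫ : (Carrier → Bool) → List Carrier → Bool
    ∫ φ []       = false
    ∫ φ (x ∷ xs) = φ x xor ∫ φ xs

    -- A list stands for the sum of its entries in 𝔽₂[M]; two lists are identified
    -- when every linear functional 𝔽₂[M] → 𝔽₂ agrees on them.
    infix 4 _≃_
    record _≃_ (u v : List Carrier) : Set (a ⊔ ℓ) where
      constructor mk≃
      field ∫-≃ : ∀ φ → Respects φ → ∫ φ u ≡ ∫ φ v
    open _≃_ public

    infixl 7 _⊗_
    _⊗_ : List Carrier → List Carrier → List Carrier
    _⊗_ = cartesianProductWith _∙_

    ∫-cong : ∀ {φ ψ} → φ ≗ ψ → ∀ u → ∫ φ u ≡ ∫ ψ u
    ∫-cong h []      = ≡.refl
    ∫-cong h (x ∷ u) = cong₂ _xor_ (h x) (∫-cong h u)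

    ∫-++ : ∀ φ u v → ∫ φ (u ++ v) ≡ ∫ φ u xor ∫ φ v
    ∫-++ φ []      v = ≡.refl
    ∫-++ φ (x ∷ u) v =
      ≡.trans (cong (φ x xor_) (∫-++ φ u v)) (≡.sym (xor-assoc (φ x) (∫ φ u) (∫ φ v)))

    ∫-map : ∀ φ f u → ∫ φ (map f u) ≡ ∫ (φ ∘ f) u
    ∫-map φ f []      = ≡.refl
    ∫-map φ f (x ∷ u) = cong (φ (f x) xor_) (∫-map φ f u)

    ∫-⊗ : ∀ φ u v → ∫ φ (u ⊗ v) ≡ ∫ (λ x → ∫ (λ y → φ (x ∙ y)) v) u
    ∫-⊗ φ []      v = ≡.refl
    ∫-⊗ φ (x ∷ u) v = ≡.trans (∫-++ φ (map (x ∙_) v) (u ⊗ v))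
      (cong₂ _xor_ (∫-map φ (x ∙_) v) (∫-⊗ φ u v))

    xor-interchange : ∀ p q r s → (p xor q) xor (r xor s) ≡ (p xor r) xor (q xor s)
    xor-interchange p q r s = begin
      (p xor q) xor (r xor s)  ≡⟨ xor-assoc p q (r xor s) ⟩
      p xor (q xor (r xor s))  ≡⟨ cong (p xor_) (≡.sym (xor-assoc q r s)) ⟩
      p xor ((q xor r) xor s)  ≡⟨ cong (λ t → p xor (t xor s)) (xor-comm q r) ⟩
      p xor ((r xor q) xor s)  ≡⟨ cong (p xor_) (xor-assoc r q s) ⟩
      p xor (r xor (q xor s))  ≡⟨ ≡.sym (xor-assoc p r (q xor s)) ⟩
      (p xor r) xor (q xor s)  ∎
      where open ≡-Reasoning

    ∫-xor : ∀ φ ψ u → ∫ (λ x → φ x xor ψ x) u ≡ ∫ φ u xor ∫ ψ u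
    ∫-xor φ ψ []      = ≡.refl
    ∫-xor φ ψ (x ∷ u) = ≡.trans (cong ((φ x xor ψ x) xor_) (∫-xor φ ψ u))
      (xor-interchange (φ x) (ψ x) (∫ φ u) (∫ ψ u))

    ∫-false : ∀ φ {u} → All (λ x → φ x ≡ false) u → ∫ φ u ≡ false
    ∫-false φ []       = ≡.refl
    ∫-false φ (p ∷ ps) = cong₂ _xor_ p (∫-false φ ps)

    ∫-respects : ∀ {φ} → Respects φ → ∀ v → Respects (λ x → ∫ (λ y → φ (x ∙ y)) v)
    ∫-respects h v x≈x′ = ∫-cong (λ y → h (∙-congʳ x≈x′)) v

    ≃-refl : ∀ {u} → u ≃ u
    ≃-refl = mk≃ λ φ h → ≡.refl

    ≃-sym : ∀ {u v} → u ≃ v → v ≃ u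
    ≃-sym e = mk≃ λ φ h → ≡.sym (∫-≃ e φ h)

    ≃-trans : ∀ {u v w} → u ≃ v → v ≃ w → u ≃ w
    ≃-trans e f = mk≃ λ φ h → ≡.trans (∫-≃ e φ h) (∫-≃ f φ h)

    ++-cong : ∀ {u u′ v v′} → u ≃ u′ → v ≃ v′ → u ++ v ≃ u′ ++ v′
    ++-cong {u} {u′} {v} {v′} e f = mk≃ λ φ h → begin
      ∫ φ (u ++ v)           ≡⟨ ∫-++ φ u v ⟩
      ∫ φ u xor ∫ φ v        ≡⟨ cong₂ _xor_ (∫-≃ e φ h) (∫-≃ f φ h) ⟩
      ∫ φ u′ xor ∫ φ v′      ≡⟨ ∫-++ φ u′ v′ ⟨
      ∫ φ (u′ ++ v′)         ∎
      where open ≡-Reasoning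

    ++-comm : ∀ u v → u ++ v ≃ v ++ u
    ++-comm u v = mk≃ λ φ h → ≡.trans (∫-++ φ u v)
      (≡.trans (xor-comm (∫ φ u) (∫ φ v)) (≡.sym (∫-++ φ v u)))

    ++-assoc : ∀ u v w → (u ++ v) ++ w ≃ u ++ (v ++ w)
    ++-assoc u v w = mk≃ λ φ h → cong (∫ φ) (assoc-++ u v w)
      where open import Data.List.Properties using () renaming (++-assoc to assoc-++)

    ++-double : ∀ u → u ++ u ≃ []
    ++-double u = mk≃ λ φ h → ≡.trans (∫-++ φ u u) (xor-same (∫ φ u))

    ++-identityʳ : ∀ u → u ++ [] ≃ u
    ++-identityʳ u = mk≃ λ φ h → ≡.trans (∫-++ φ u []) (xor-identityʳ (∫ φ u))

    ⊗-cong : ∀ {u u′ v v′} → u ≃ u′ → v ≃ v′ → u ⊗ v ≃ u′ ⊗ v′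
    ⊗-cong {u} {u′} {v} {v′} e f = mk≃ λ φ h → begin
      ∫ φ (u ⊗ v)                              ≡⟨ ∫-⊗ φ u v ⟩
      ∫ (λ x → ∫ (λ y → φ (x ∙ y)) v) u        ≡⟨ ∫-cong (λ x → ∫-≃ f _ (h ∘ ∙-congˡ)) u ⟩
      ∫ (λ x → ∫ (λ y → φ (x ∙ y)) v′) u       ≡⟨ ∫-≃ e _ (∫-respects h v′) ⟩
      ∫ (λ x → ∫ (λ y → φ (x ∙ y)) v′) u′      ≡⟨ ∫-⊗ φ u′ v′ ⟨
      ∫ φ (u′ ⊗ v′)                            ∎
      where open ≡-Reasoning

    ⊗-assoc : ∀ u v w → (u ⊗ v) ⊗ w ≃ u ⊗ (v ⊗ w)
    ⊗-assoc u v w = mk≃ λ φ h → begin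
      ∫ φ ((u ⊗ v) ⊗ w)
        ≡⟨ ∫-⊗ φ (u ⊗ v) w ⟩
      ∫ (λ s → ∫ (λ z → φ (s ∙ z)) w) (u ⊗ v)
        ≡⟨ ∫-⊗ _ u v ⟩
      ∫ (λ x → ∫ (λ y → ∫ (λ z → φ (x ∙ y ∙ z)) w) v) u
        ≡⟨ ∫-cong (λ x → ∫-cong (λ y → ∫-cong (λ z → h (assoc x y z)) w) v) u ⟩
      ∫ (λ x → ∫ (λ y → ∫ (λ z → φ (x ∙ (y ∙ z))) w) v) u
        ≡⟨ ∫-cong (λ x → ∫-⊗ (λ s → φ (x ∙ s)) v w) u ⟨
      ∫ (λ x → ∫ (λ s → φ (x ∙ s)) (v ⊗ w)) u
        ≡⟨ ∫-⊗ φ u (v ⊗ w) ⟨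
      ∫ φ (u ⊗ (v ⊗ w))
        ∎
      where open ≡-Reasoning

    ⊗-identityˡ : ∀ u → (ε ∷ []) ⊗ u ≃ u
    ⊗-identityˡ u = mk≃ λ φ h → ≡.trans (∫-⊗ φ (ε ∷ []) u)
      (≡.trans (xor-identityʳ _) (∫-cong (λ y → h (identityˡ y)) u))

    ⊗-identityʳ : ∀ u → u ⊗ (ε ∷ []) ≃ u
    ⊗-identityʳ u = mk≃ λ φ h → ≡.trans (∫-⊗ φ u (ε ∷ []))
      (∫-cong (λ x → ≡.trans (xor-identityʳ _) (h (identityʳ x))) u)

    ⊗-distribˡ : ∀ u v w → u ⊗ (v ++ w) ≃ u ⊗ v ++ u ⊗ w
    ⊗-distribˡ u v w = mk≃ λ φ h → begin
      ∫ φ (u ⊗ (v ++ w))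
        ≡⟨ ∫-⊗ φ u (v ++ w) ⟩
      ∫ (λ x → ∫ (λ y → φ (x ∙ y)) (v ++ w)) u
        ≡⟨ ∫-cong (λ x → ∫-++ _ v w) u ⟩
      ∫ (λ x → ∫ (λ y → φ (x ∙ y)) v xor ∫ (λ y → φ (x ∙ y)) w) u
        ≡⟨ ∫-xor _ _ u ⟩
      ∫ (λ x → ∫ (λ y → φ (x ∙ y)) v) u xor ∫ (λ x → ∫ (λ y → φ (x ∙ y)) w) u
        ≡⟨ cong₂ _xor_ (∫-⊗ φ u v) (∫-⊗ φ u w) ⟨
      ∫ φ (u ⊗ v) xor ∫ φ (u ⊗ w)
        ≡⟨ ∫-++ φ (u ⊗ v) (u ⊗ w) ⟨
      ∫ φ (u ⊗ v ++ u ⊗ w)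
        ∎
      where open ≡-Reasoning

    ⊗-distribʳ : ∀ u v w → (v ++ w) ⊗ u ≃ v ⊗ u ++ w ⊗ u
    ⊗-distribʳ u v w = mk≃ λ φ h → begin
      ∫ φ ((v ++ w) ⊗ u)           ≡⟨ ∫-⊗ φ (v ++ w) u ⟩
      ∫ _ (v ++ w)                 ≡⟨ ∫-++ _ v w ⟩
      ∫ _ v xor ∫ _ w              ≡⟨ cong₂ _xor_ (∫-⊗ φ v u) (∫-⊗ φ w u) ⟨
      ∫ φ (v ⊗ u) xor ∫ φ (w ⊗ u)  ≡⟨ ∫-++ φ (v ⊗ u) (w ⊗ u) ⟨
      ∫ φ (v ⊗ u ++ w ⊗ u)         ∎
      where open ≡-Reasoning

    monoidRing : Ring a (a ⊔ ℓ)
    monoidRing = record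
      { Carrier = List Carrier ; _≈_ = _≃_ ; _+_ = _++_ ; _*_ = _⊗_ ; -_ = λ u → u
      ; 0# = [] ; 1# = ε ∷ []
      ; isRing = record
        { +-isAbelianGroup = record
          { isGroup = record
            { isMonoid = record
              { isSemigroup = record
                { isMagma = record
                  { isEquivalence = record { refl = ≃-refl ; sym = ≃-sym ; trans = ≃-trans }
                  ; ∙-cong = ++-cong
                  }
                ; assoc = ++-assoc
                }
              ; identity = (λ u → ≃-refl) , ++-identityʳ
              }
            ; inverse = ++-double , ++-double
            ; ⁻¹-cong = λ e → e
            }
          ; comm = ++-comm
          }
        ; *-cong = ⊗-cong
        ; *-assoc = ⊗-assoc
        ; *-identity = ⊗-identityˡ , ⊗-identityʳ
        ; distrib = ⊗-distribˡ , ⊗-distribʳ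
        }
      }

    module Sorting (_<_ : Carrier → Carrier → Set ℓ)
      (<-trans : ∀ {x y z} → x < y → y < z → x < z)
      (compare : ∀ x y → x < y ⊎ (x ≈ y ⊎ y < x)) where

      private
        _>_ : Carrier → Carrier → Set ℓ
        x > y = y < x

      insert : Carrier → List Carrier → List Carrier
      insert x []      = x ∷ []
      insert x (y ∷ u) with compare x y
      ... | inj₁ x<y        = y ∷ insert x u
      -- Two equal terms cancel, as the coefficients lie in 𝔽₂.
      ... | inj₂ (inj₁ x≈y) = u
      ... | inj₂ (inj₂ y<x) = x ∷ y ∷ u

      insert-≃ : ∀ x u → insert x u ≃ x ∷ u
      insert-≃ x []      = ≃-refl
      insert-≃ x (y ∷ u) with compare x y
      ... | inj₁ x<y        = mk≃ λ φ h → begin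
        φ y xor ∫ φ (insert x u)  ≡⟨ cong (φ y xor_) (∫-≃ (insert-≃ x u) φ h) ⟩
        φ y xor (φ x xor ∫ φ u)   ≡⟨ xor-assoc (φ y) (φ x) _ ⟨
        (φ y xor φ x) xor ∫ φ u   ≡⟨ cong (_xor ∫ φ u) (xor-comm (φ y) (φ x)) ⟩
        (φ x xor φ y) xor ∫ φ u   ≡⟨ xor-assoc (φ x) (φ y) _ ⟩
        φ x xor (φ y xor ∫ φ u)   ∎
        where open ≡-Reasoning
      ... | inj₂ (inj₁ x≈y) = mk≃ λ φ h → begin
        ∫ φ u                     ≡⟨⟩
        false xor ∫ φ u           ≡⟨ cong (_xor ∫ φ u) (xor-same (φ y)) ⟨
        (φ y xor φ y) xor ∫ φ u   ≡⟨ cong (λ b → (b xor φ y) xor ∫ φ u) (h x≈y) ⟨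
        (φ x xor φ y) xor ∫ φ u   ≡⟨ xor-assoc (φ x) (φ y) _ ⟩
        φ x xor (φ y xor ∫ φ u)   ∎
        where open ≡-Reasoning
      ... | inj₂ (inj₂ y<x) = ≃-refl

      insert-All : ∀ {p} {P : Carrier → Set p} x u → P x → All P u → All P (insert x u)
      insert-All x []      px []         = px ∷ []
      insert-All x (y ∷ u) px (py ∷ pu) with compare x y
      ... | inj₁ x<y        = py ∷ insert-All x u px pu
      ... | inj₂ (inj₁ x≈y) = pu
      ... | inj₂ (inj₂ y<x) = px ∷ py ∷ pu

      insert-sorted : ∀ x u → AllPairs _>_ u → AllPairs _>_ (insert x u)
      insert-sorted x []      []         = [] ∷ []
      insert-sorted x (y ∷ u) (py ∷ pu) with compare x y
      ... | inj₁ x<y        = insert-All x u x<y py ∷ insert-sorted x u pu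
      ... | inj₂ (inj₁ x≈y) = pu
      ... | inj₂ (inj₂ y<x) = (y<x ∷ All.map (λ z<y → <-trans z<y y<x) py) ∷ py ∷ pu

      sort : List Carrier → List Carrier
      sort []      = []
      sort (x ∷ u) = insert x (sort u)

      sort-≃ : ∀ u → sort u ≃ u
      sort-≃ []      = ≃-refl
      sort-≃ (x ∷ u) =
        ≃-trans (insert-≃ x (sort u)) (mk≃ λ φ h → cong (φ x xor_) (∫-≃ (sort-≃ u) φ h))

      sort-All : ∀ {p} {P : Carrier → Set p} u → All P u → All P (sort u)
      sort-All []      []        = []
      sort-All (x ∷ u) (px ∷ pu) = insert-All x (sort u) px (sort-All u pu)

      sort-sorted : ∀ u → AllPairs _>_ (sort u)
      sort-sorted []      = []
      sort-sorted (x ∷ u) = insert-sorted x (sort u) (sort-sorted u)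

      leading : ∀ u → u ≃ [] ⊎ ∃₂ λ x v → u ≃ x ∷ v × All (_< x) v
      leading u with sort u | sort-≃ u | sort-sorted u
      ... | []    | e | _      = inj₁ (≃-sym e)
      ... | x ∷ v | e | px ∷ _ = inj₂ (x , v , ≃-sym e , px)

    module Ordered (_<_ : Carrier → Carrier → Set ℓ)
      (<-trans : ∀ {x y z} → x < y → y < z → x < z)
      (compare : ∀ x y → x < y ⊎ (x ≈ y ⊎ y < x))
      (<-irrefl : ∀ {x y} → x ≈ y → ¬ (x < y))
      (<-monoʳ : ∀ {x y} z → x < y → (x ∙ z) < (y ∙ z))
      (cancelˡ : ∀ {x y} z → z ∙ x ≈ z ∙ y → x ≈ y) where

      infix 4 _≟_
      _≟_ : ∀ x y → Dec (x ≈ y)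
      x ≟ y with compare x y
      ... | inj₁ x<y        = no λ x≈y → <-irrefl x≈y x<y
      ... | inj₂ (inj₁ x≈y) = yes x≈y
      ... | inj₂ (inj₂ y<x) = no λ x≈y → <-irrefl (sym x≈y) y<x

      coeff : Carrier → Carrier → Bool
      coeff m x = does (x ≟ m)

      coeff-≈ : ∀ {m x} → x ≈ m → coeff m x ≡ true
      coeff-≈ {m} {x} = dec-true (x ≟ m)

      coeff-≉ : ∀ {m x} → ¬ (x ≈ m) → coeff m x ≡ false
      coeff-≉ {m} {x} = dec-false (x ≟ m)

      coeff-< : ∀ {m x} → x < m → coeff m x ≡ false
      coeff-< x<m = coeff-≉ λ x≈m → <-irrefl x≈m x<m

      coeff-respects : ∀ m → Respects (coeff m)
      coeff-respects m {x} {y} x≈y with y ≟ m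
      ... | yes y≈m = coeff-≈ (trans x≈y y≈m)
      ... | no  y≉m = coeff-≉ λ x≈m → y≉m (trans (sym x≈y) x≈m)

      open Sorting _<_ <-trans compare

      singleton≄[] : ∀ x → ¬ (x ∷ [] ≃ [])
      singleton≄[] x e with ≡.trans (≡.sym (∫-≃ e (coeff x) (coeff-respects x)))
                                    (cong (_xor false) (coeff-≈ {x} refl))
      ... | ()

      singleton-injective : ∀ {x y} → x ∷ [] ≃ y ∷ [] → x ≈ y
      singleton-injective {x} {y} e with x ≟ y
      ... | yes x≈y = x≈y
      ... | no  x≉y with ≡.trans (≡.sym (∫-≃ e (coeff y) (coeff-respects y)))
                                 (cong (_xor false) (coeff-≉ x≉y))
      ...   | h with ≡.trans (≡.sym (cong (_xor false) (coeff-≈ {y} refl))) h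
      ...     | ()

      -- If x is the largest term of u and y the term of v with x y largest,
      -- then x y occurs exactly once in the product.
      integral : ∀ u v → u ⊗ v ≃ [] → u ≃ [] ⊎ v ≃ []
      integral u v e with leading u
      ... | inj₁ u≃[] = inj₁ u≃[]
      ... | inj₂ (x , u′ , u≃ , u′<x) with Twisted.leading v
        where
        -- Left multiplication by `x` need not be monotone, so `v` is sorted by the order pulled
        -- back along it; `cancelˡ` turns a tie of the products into y ≈ z, as `Sorting` demands.
        twisted : ∀ y z → (x ∙ y) < (x ∙ z) ⊎ (y ≈ z ⊎ (x ∙ z) < (x ∙ y))
        twisted y z with compare (x ∙ y) (x ∙ z)
        ... | inj₁ p        = inj₁ p
        ... | inj₂ (inj₁ p) = inj₂ (inj₁ (cancelˡ x p))
        ... | inj₂ (inj₂ p) = inj₂ (inj₂ p)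
        module Twisted = Sorting (λ y z → (x ∙ y) < (x ∙ z)) <-trans twisted
      ...   | inj₁ v≃[] = inj₂ v≃[]
      ...   | inj₂ (y , v′ , v≃ , v′<y) = contradiction e λ e →
              false≢true (≡.trans (≡.sym (vanishes e)) one)
        where
        φ = coeff (x ∙ y)

        false≢true : ¬ (false ≡ true)
        false≢true ()

        vanishes : u ⊗ v ≃ [] → ∫ φ ((x ∷ u′) ⊗ (y ∷ v′)) ≡ false
        vanishes e = ∫-≃ (≃-trans (⊗-cong (≃-sym u≃) (≃-sym v≃)) e) φ (coeff-respects (x ∙ y))

        below : ∀ {x′} → x′ < x → ∫ (λ y′ → φ (x′ ∙ y′)) (y ∷ v′) ≡ false
        below x′<x = ∫-false _
          (coeff-< (<-monoʳ y x′<x) ∷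
           All.map (λ {y′} p → coeff-< (<-trans (<-monoʳ y′ x′<x) p)) v′<y)

        one : ∫ φ ((x ∷ u′) ⊗ (y ∷ v′)) ≡ true
        one = ≡.trans (∫-⊗ φ (x ∷ u′) (y ∷ v′)) (cong₂ _xor_
          (cong₂ _xor_ (coeff-≈ refl) (∫-false _ (All.map coeff-< v′<y)))
          (∫-false _ (All.map below u′<x)))

      -- Otherwise the largest term of `u` after sorting would be one of the `T k`, and the
      -- coefficient there would be 1.
      ≃[]-by-coeff : ∀ {m} (T : Fin m → Carrier) u → All (λ x → ∃ λ k → x ≈ T k) u →
                     (∀ k → ∫ (coeff (T k)) u ≡ false) → u ≃ []
      ≃[]-by-coeff T u p h with sort u | sort-≃ u | sort-sorted u | sort-All u p
      ... | []    | e | _       | _ = ≃-sym e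
      ... | x ∷ v | e | x>v ∷ _ | (k , x≈Tk) ∷ _ =
        contradiction (≡.trans (≡.sym (h k)) (≡.trans (≡.sym (∫-≃ e _ (coeff-respects (T k)))) lead))
          λ ()
        where
        lead : ∫ (coeff (T k)) (x ∷ v) ≡ true
        lead = cong₂ _xor_ (coeff-≈ x≈Tk) (∫-false _
          (All.map (λ z<x → coeff-≉ λ z≈Tk → <-irrefl (trans z≈Tk (sym x≈Tk)) z<x) x>v))

      combination : ∀ {n} → (Fin n → Carrier) → (Fin n → Bool) → List Carrier
      combination {zero}  S d = []
      combination {suc n} S d = (if d zero then S zero ∷_ else id) (combination (S ∘ suc) (d ∘ suc))

      combination-All : ∀ {p} {P : Carrier → Set p} {n} (S : Fin n → Carrier) d →
                        (∀ k → P (S k)) → All P (combination S d)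
      combination-All {n = zero}  S d h = []
      combination-All {n = suc n} S d h with d zero
      ... | true  = h zero ∷ combination-All (S ∘ suc) (d ∘ suc) (h ∘ suc)
      ... | false = combination-All (S ∘ suc) (d ∘ suc) (h ∘ suc)

      ∫-combination-suc : ∀ φ {n} (S : Fin (suc n) → Carrier) d →
        ∫ φ (combination S d) ≡ (d zero ∧ φ (S zero)) xor ∫ φ (combination (S ∘ suc) (d ∘ suc))
      ∫-combination-suc φ S d with d zero
      ... | true  = ≡.refl
      ... | false = ≡.refl

      ∫-combination-xor : ∀ φ {n} (S : Fin n → Carrier) d d′ →
        ∫ φ (combination S (λ k → d k xor d′ k)) ≡ ∫ φ (combination S d) xor ∫ φ (combination S d′)
      ∫-combination-xor φ {zero}  S d d′ = ≡.refl
      ∫-combination-xor φ {suc n} S d d′ = begin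
        ∫ φ (combination S (λ k → d k xor d′ k))
          ≡⟨ ∫-combination-suc φ S (λ k → d k xor d′ k) ⟩
        ((d zero xor d′ zero) ∧ φ (S zero)) xor ∫ φ (combination (S ∘ suc) (λ k → d (suc k) xor d′ (suc k)))
          ≡⟨ cong₂ _xor_ (∧-distribʳ-xor (φ (S zero)) (d zero) (d′ zero))
                         (∫-combination-xor φ (S ∘ suc) (d ∘ suc) (d′ ∘ suc)) ⟩
        ((d zero ∧ φ (S zero)) xor (d′ zero ∧ φ (S zero))) xor
        (∫ φ (combination (S ∘ suc) (d ∘ suc)) xor ∫ φ (combination (S ∘ suc) (d′ ∘ suc)))
          ≡⟨ xor-interchange (d zero ∧ φ (S zero)) _ _ _ ⟩
        ((d zero ∧ φ (S zero)) xor ∫ φ (combination (S ∘ suc) (d ∘ suc))) xor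
        ((d′ zero ∧ φ (S zero)) xor ∫ φ (combination (S ∘ suc) (d′ ∘ suc)))
          ≡⟨ cong₂ _xor_ (∫-combination-suc φ S d) (∫-combination-suc φ S d′) ⟨
        ∫ φ (combination S d) xor ∫ φ (combination S d′)
          ∎
        where open ≡-Reasoning

      ∫-coeff-combination : ∀ {n} (S : Fin n → Carrier) (d : Fin n → Bool) →
        (∀ i j → S i ≈ S j → i ≡ j) → ∀ k → ∫ (coeff (S k)) (combination S d) ≡ d k
      ∫-coeff-combination {suc n} S d inj zero = begin
        ∫ (coeff (S zero)) (combination S d)         ≡⟨ ∫-combination-suc _ S d ⟩
        (d zero ∧ coeff (S zero) (S zero)) xor _     ≡⟨ cong₂ (λ p q → (d zero ∧ p) xor q) (coeff-≈ refl)
          (∫-false _ (combination-All (S ∘ suc) (d ∘ suc) λ k →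
            coeff-≉ λ e → contradiction (inj (suc k) zero e) λ ())) ⟩
        (d zero ∧ true) xor false                    ≡⟨ xor-identityʳ _ ⟩
        d zero ∧ true                                ≡⟨ ∧-identityʳ (d zero) ⟩
        d zero                                       ∎
        where open ≡-Reasoning
      ∫-coeff-combination {suc n} S d inj (suc k) = begin
        ∫ (coeff (S (suc k))) (combination S d)      ≡⟨ ∫-combination-suc _ S d ⟩
        (d zero ∧ coeff (S (suc k)) (S zero)) xor _  ≡⟨ cong₂ (λ p q → (d zero ∧ p) xor q)
          (coeff-≉ λ e → contradiction (inj zero (suc k) e) λ ())
          (∫-coeff-combination (S ∘ suc) (d ∘ suc) (λ i j e → suc-injective (inj (suc i) (suc j) e)) k) ⟩
        (d zero ∧ false) xor d (suc k)               ≡⟨ cong (_xor d (suc k)) (∧-zeroʳ (d zero)) ⟩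
        d (suc k)                                    ∎
        where open ≡-Reasoning

      -- `T` only has to cover the products and may repeat elements, so the size of the product set
      -- is bounded and never counted.
      Følner : Set (a ⊔ ℓ)
      Følner = ∀ (X : List Carrier) → ∃₂ λ n m → Σ (Fin n → Carrier) λ S → Σ (Fin m → Carrier) λ T →
        (m Data.Nat.< n + n) × (∀ i j → S i ≈ S j → i ≡ j) ×
        (∀ i → All (λ x → ∃ λ k → S i ∙ x ≈ T k) X)

      -- The 𝔽₂-space of pairs (r , s) supported on S has dimension 2 |S|, while
      -- r u + s v is supported on T and |T| < 2 |S|.
      følner⇒ore : Følner → ∀ u v → ¬ (v ≃ []) → ∃₂ λ r s → ¬ (r ≃ []) × r ⊗ u ≃ s ⊗ v
      følner⇒ore følner u v v≄[] with følner (u ++ v)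
      ... | n , m , S , T , m<n+n , S-injective , covers
        with pigeonhole (^-monoʳ-< 2 (s≤s (s≤s z≤n)) m<n+n) image
        where
        value : (Fin (n + n) → Bool) → List Carrier
        value d = combination S (d ∘ (_↑ˡ n)) ⊗ u ++ combination S (d ∘ (n ↑ʳ_)) ⊗ v
        image : Fin (2 ^ (n + n)) → Fin (2 ^ m)
        image i = funToFin λ k → unbit (∫ (coeff (T k)) (value (bit ∘ finToFun {2} {n + n} i)))
      ... | i , j , i<j , image≡ = r , s , r≄[] , ru≃sv
        where
        bits : Fin (2 ^ (n + n)) → Fin (n + n) → Bool
        bits i = bit ∘ finToFun {2} {n + n} i

        value : (Fin (n + n) → Bool) → List Carrier
        value d = combination S (d ∘ (_↑ˡ n)) ⊗ u ++ combination S (d ∘ (n ↑ʳ_)) ⊗ v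

        -- The difference of two distinct vectors with the same image: a nonzero element of the
        -- kernel of a linear map, found by counting instead of elimination.
        d : Fin (n + n) → Bool
        d k = bits i k xor bits j k

        r s : List Carrier
        r = combination S (d ∘ (_↑ˡ n))
        s = combination S (d ∘ (n ↑ʳ_))

        ∫-combination-⊗-xor : ∀ φ w (e e′ : Fin n → Bool) →
          ∫ φ (combination S (λ k → e k xor e′ k) ⊗ w) ≡
          ∫ φ (combination S e ⊗ w) xor ∫ φ (combination S e′ ⊗ w)
        ∫-combination-⊗-xor φ w e e′ = begin
          ∫ φ (combination S (λ k → e k xor e′ k) ⊗ w)
            ≡⟨ ∫-⊗ φ (combination S (λ k → e k xor e′ k)) w ⟩
          ∫ _ (combination S (λ k → e k xor e′ k))      ≡⟨ ∫-combination-xor _ S e e′ ⟩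
          ∫ _ (combination S e) xor ∫ _ (combination S e′)
            ≡⟨ cong₂ _xor_ (∫-⊗ φ (combination S e) w) (∫-⊗ φ (combination S e′) w) ⟨
          ∫ φ (combination S e ⊗ w) xor ∫ φ (combination S e′ ⊗ w) ∎
          where open ≡-Reasoning

        ∫-value-xor : ∀ φ → ∫ φ (value d) ≡ ∫ φ (value (bits i)) xor ∫ φ (value (bits j))
        ∫-value-xor φ = begin
          ∫ φ (value d)                     ≡⟨ ∫-++ φ (r ⊗ u) (s ⊗ v) ⟩
          ∫ φ (r ⊗ u) xor ∫ φ (s ⊗ v)
            ≡⟨ cong₂ _xor_ (∫-combination-⊗-xor φ u (bits i ∘ (_↑ˡ n)) (bits j ∘ (_↑ˡ n)))
                           (∫-combination-⊗-xor φ v (bits i ∘ (n ↑ʳ_)) (bits j ∘ (n ↑ʳ_))) ⟩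
          _ ≡⟨ xor-interchange (∫ φ (combination S (bits i ∘ (_↑ˡ n)) ⊗ u)) _ _ _ ⟩
          _ ≡⟨ cong₂ _xor_ (∫-++ φ (combination S (bits i ∘ (_↑ˡ n)) ⊗ u) _)
                           (∫-++ φ (combination S (bits j ∘ (_↑ˡ n)) ⊗ u) _) ⟨
          ∫ φ (value (bits i)) xor ∫ φ (value (bits j)) ∎
          where open ≡-Reasoning

        value-T : ∀ k → ∫ (coeff (T k)) (value d) ≡ false
        value-T k = ≡.trans (∫-value-xor (coeff (T k))) (unbit-xor
          (≡.trans (≡.sym (finToFun-funToFin (λ k → unbit (∫ (coeff (T k)) (value (bits i)))) k))
          (≡.trans (cong (λ t → finToFun t k) image≡)
                   (finToFun-funToFin (λ k → unbit (∫ (coeff (T k)) (value (bits j)))) k))))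

        ⊗-covered : ∀ w (e : Fin n → Bool) → (∀ i → All (λ x → ∃ λ k → S i ∙ x ≈ T k) w) →
          All (λ x → ∃ λ k → x ≈ T k) (combination S e ⊗ w)
        ⊗-covered w e h = go (combination S e) (combination-All S e h)
          where
          go : ∀ t → All (λ z → All (λ x → ∃ λ k → z ∙ x ≈ T k) w) t →
               All (λ x → ∃ λ k → x ≈ T k) (t ⊗ w)
          go []      []       = []
          go (z ∷ t) (p ∷ ps) = All.++⁺ (All.map⁺ p) (go t ps)

        value≃[] : value d ≃ []
        value≃[] = ≃[]-by-coeff T (value d)
          (All.++⁺ (⊗-covered u (d ∘ (_↑ˡ n)) (λ i → All.++⁻ˡ u (covers i)))
                   (⊗-covered v (d ∘ (n ↑ʳ_)) (λ i → All.++⁻ʳ u (covers i)))) value-T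

        open RingProperties monoidRing using (+-inverseˡ-unique)

        ru≃sv : r ⊗ u ≃ s ⊗ v
        ru≃sv = +-inverseˡ-unique (r ⊗ u) (s ⊗ v) value≃[]

        combination≃[] : ∀ e → combination S e ≃ [] → ∀ k → e k ≡ false
        combination≃[] e h k = ≡.trans (≡.sym (∫-coeff-combination S e S-injective k))
          (∫-≃ h (coeff (S k)) (coeff-respects (S k)))

        -- If r vanished, s v = 0 would force s = 0 because v ≠ 0. Then all bits of `d` vanish, and
        -- the colliding indices `i` and `j` coincide.
        r≄[] : ¬ (r ≃ [])
        r≄[] r≃[] with integral s v (≃-trans (≃-sym ru≃sv) (⊗-cong r≃[] (≃-refl {u})))
        ... | inj₂ v≃[] = v≄[] v≃[]
        ... | inj₁ s≃[] = <ᶠ⇒≢ i<j (finToFun-injective {2} {n + n} λ k → bit-xor _ _ (d≡false k))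
          where
          d≡false : ∀ k → d k ≡ false
          d≡false k with splitAt n k | join-splitAt n n k
          ... | inj₁ l | ≡.refl = combination≃[] (d ∘ (_↑ˡ n)) r≃[] l
          ... | inj₂ l | ≡.refl = combination≃[] (d ∘ (n ↑ʳ_)) s≃[] l

-- The right-ordered monoid of periodic functions, translations and dilations.

module DilationMonoid where

  open import Level using (0ℓ)
  open import Algebra.Bundles using (Monoid)
  open import Data.Nat using (ℕ; zero; suc; _+_; _*_; _∸_; _^_; _≤_; _<_; z≤n; NonZero; nonZero)
  open import Data.Nat.Properties
  open import Data.Nat.Divisibility using (_∣_; divides; divides-refl; _∣?_; ∣m+n∣m⇒∣n; n∣m*n; m*n∣⇒n∣; *-cancelʳ-∣)
  open import Data.Nat.Solver using (module +-*-Solver)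
  open import Data.Product using (∃; _×_; _,_)
  open import Data.Product.Relation.Binary.Lex.Strict using (×-strictTotalOrder)
  open import Data.Sum using (_⊎_; inj₁; inj₂)
  open import Relation.Binary.Bundles using (StrictTotalOrder)
  open import Relation.Binary.Definitions using (tri<; tri≈; tri>; Trichotomous)
  open import Relation.Binary.PropositionalEquality as ≡ using (_≡_; _≢_; _≗_; refl; sym; trans; cong; cong₂; subst; module ≡-Reasoning)
  open import Relation.Binary.Structures.Biased using (isStrictTotalOrderᶜ)
  open import Relation.Nullary using (¬_; yes; no; contradiction)

  dilate : ℕ → (ℕ → ℕ) → ℕ → ℕ
  dilate e ψ m with e ∣? m
  ... | yes (divides q _) = ψ q
  ... | no _              = 0

  module _ {e : ℕ} .{{_ : NonZero e}} where

    dilate-multiple : ∀ ψ q → dilate e ψ (q * e) ≡ ψ q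
    dilate-multiple ψ q with e ∣? q * e
    ... | yes (divides q′ eq) = cong ψ (sym (*-cancelʳ-≡ q q′ e eq))
    ... | no  ∤             = contradiction (n∣m*n q) ∤

    dilate-∤ : ∀ ψ {m} → ¬ (e ∣ m) → dilate e ψ m ≡ 0
    dilate-∤ ψ {m} ∤ with e ∣? m
    ... | yes e∣m = contradiction e∣m ∤
    ... | no  _   = refl

    dilate-cong : ∀ {ψ χ} → ψ ≗ χ → dilate e ψ ≗ dilate e χ
    dilate-cong h m with e ∣? m
    ... | yes (divides q _) = h q
    ... | no  _             = refl

    dilate-+ : ∀ ψ χ m → dilate e (λ k → ψ k + χ k) m ≡ dilate e ψ m + dilate e χ m
    dilate-+ ψ χ m with e ∣? m
    ... | yes _ = refl
    ... | no  _ = refl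

    dilate-0 : ∀ m → dilate e (λ _ → 0) m ≡ 0
    dilate-0 m with e ∣? m
    ... | yes _ = refl
    ... | no  _ = refl

    dilate-≤ : ∀ {ψ b} → (∀ k → ψ k ≤ b) → ∀ m → dilate e ψ m ≤ b
    dilate-≤ h m with e ∣? m
    ... | yes (divides q _) = h q
    ... | no  _             = z≤n

    -- The relations p v = v² p and q v = v³ q, read as identities between operators on functions.
    -- Associativity and periodicity of products rest on it.
    dilate-shift : ∀ ψ m n → dilate e ψ (m + n * e) ≡ dilate e (λ k → ψ (k + n)) m
    dilate-shift ψ m n with e ∣? m
    ... | yes (divides-refl q) =
      trans (cong (dilate e ψ) (sym (*-distribʳ-+ e q n))) (dilate-multiple ψ (q + n))
    ... | no ∤ = dilate-∤ ψ λ e∣ →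
      ∤ (∣m+n∣m⇒∣n (subst (e ∣_) (+-comm m (n * e)) e∣) (n∣m*n n))

    dilate-dilate : ∀ ψ e′ .{{_ : NonZero e′}} m → dilate e (dilate e′ ψ) m ≡ dilate (e′ * e) ψ m
    dilate-dilate ψ e′ m with e ∣? m | e′ * e ∣? m
    ... | no e∤ | yes e′e∣ = contradiction (m*n∣⇒n∣ e′ e e′e∣) e∤
    ... | no _  | no _     = refl
    ... | yes (divides-refl q) | no ∤ with e′ ∣? q
    ...   | yes (divides-refl k) =
            contradiction (divides k (*-assoc k e′ e)) ∤
    ...   | no  _              = refl
    dilate-dilate ψ e′ m | yes (divides-refl q) | yes (divides k eq) with e′ ∣? q
    ...   | yes (divides-refl l) = cong ψ (*-cancelʳ-≡ l k (e′ * e) {{m*n≢0 e′ e}} (trans (sym (*-assoc l e′ e)) eq))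
    ...   | no ∤ = contradiction (*-cancelʳ-∣ e (divides k eq)) ∤

  dilate-1 : ∀ ψ m → dilate 1 ψ m ≡ ψ m
  dilate-1 ψ m = trans (cong (dilate 1 ψ) (sym (*-identityʳ m))) (dilate-multiple ψ m)

  -- The period makes the search for a first difference finite and lets values lost under a
  -- translation of ℕ be read off further on. The bound is what places a function in a finite box.
  record Periodic : Set where
    field
      fun       : ℕ → ℕ
      period    : ℕ
      period≢0  : NonZero period
      periodic  : ∀ k → fun (k + period) ≡ fun k
      bound     : ℕ
      bounded   : ∀ k → fun k ≤ bound
  open Periodic

  periodic-multiple : ∀ (ψ : ℕ → ℕ) p → (∀ k → ψ (k + p) ≡ ψ k) → ∀ n k → ψ (k + n * p) ≡ ψ k
  periodic-multiple ψ p h zero    k = cong ψ (+-identityʳ k)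
  periodic-multiple ψ p h (suc n) k = begin
    ψ (k + (p + n * p)) ≡⟨ cong ψ (+-assoc k p (n * p)) ⟨
    ψ (k + p + n * p)   ≡⟨ periodic-multiple ψ p h n (k + p) ⟩
    ψ (k + p)           ≡⟨ h k ⟩
    ψ k                 ∎
    where open ≡-Reasoning

  _≺_ : Periodic → Periodic → Set
  ψ ≺ χ = ∃ λ k → fun ψ k < fun χ k × (∀ l → l < k → fun ψ l ≡ fun χ l)

  _≗ᵖ_ : Periodic → Periodic → Set
  ψ ≗ᵖ χ = fun ψ ≗ fun χ

  ≺-trans : ∀ {ψ χ ω} → ψ ≺ χ → χ ≺ ω → ψ ≺ ω
  ≺-trans (k , p , h) (k′ , p′ , h′) with <-cmp k k′
  ... | tri< k<k′ _ _ = k , subst (_ <_) (h′ k k<k′) p ,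
                        λ l l<k → trans (h l l<k) (h′ l (<-trans l<k k<k′))
  ... | tri≈ _ refl _ = k , <-trans p p′ , λ l l<k → trans (h l l<k) (h′ l l<k)
  ... | tri> _ _ k′<k = k′ , subst (_< _) (sym (h k′ k′<k)) p′ ,
                        λ l l<k′ → trans (h l (<-trans l<k′ k′<k)) (h′ l l<k′)

  ≺-irrefl : ∀ {ψ χ} → ψ ≗ᵖ χ → ¬ (ψ ≺ χ)
  ≺-irrefl e (k , p , _) = <-irrefl (e k) p

  first-difference : ∀ (ψ χ : ℕ → ℕ) n →
    (∀ l → l < n → ψ l ≡ χ l) ⊎ ∃ λ k → ψ k ≢ χ k × (∀ l → l < k → ψ l ≡ χ l)
  first-difference ψ χ zero    = inj₁ λ l ()
  first-difference ψ χ (suc n) with first-difference ψ χ n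
  ... | inj₂ d = inj₂ d
  ... | inj₁ h with ψ n ≟ χ n
  ...   | no  ψn≢χn = inj₂ (n , ψn≢χn , h)
  ...   | yes ψn≡χn = inj₁ λ l l<1+n → case (m<1+n⇒m<n∨m≡n l<1+n)
    where
    case : ∀ {l} → l < n ⊎ l ≡ n → ψ l ≡ χ l
    case (inj₁ l<n)  = h _ l<n
    case (inj₂ refl) = ψn≡χn

  ≗-from-period : ∀ (ψ χ : ℕ → ℕ) p .{{_ : NonZero p}} →
    (∀ k → ψ (k + p) ≡ ψ k) → (∀ k → χ (k + p) ≡ χ k) →
    (∀ l → l < p → ψ l ≡ χ l) → ψ ≗ χ
  ≗-from-period ψ χ p hψ hχ h k = begin
    ψ k                       ≡⟨ cong ψ (m≡m%n+[m/n]*n k p) ⟩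
    ψ (k % p + (k / p) * p)   ≡⟨ periodic-multiple ψ p hψ (k / p) (k % p) ⟩
    ψ (k % p)                 ≡⟨ h (k % p) (m%n<n k p) ⟩
    χ (k % p)                 ≡⟨ periodic-multiple χ p hχ (k / p) (k % p) ⟨
    χ (k % p + (k / p) * p)   ≡⟨ cong χ (m≡m%n+[m/n]*n k p) ⟨
    χ k                       ∎
    where
    open ≡-Reasoning
    open import Data.Nat.DivMod

  -- Functions that agree below a common period agree everywhere, so the search for a difference may
  -- stop at the product of the two periods.
  ≺-cmp : Trichotomous _≗ᵖ_ _≺_
  ≺-cmp ψ χ with first-difference (fun ψ) (fun χ) (period ψ * period χ)
  ... | inj₁ h = tri≈ (λ p → ≺-irrefl {ψ} {χ} e p) e (λ p → ≺-irrefl {χ} {ψ} (λ k → sym (e k)) p)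
    where
    e : ψ ≗ᵖ χ
    e = ≗-from-period (fun ψ) (fun χ) (period ψ * period χ)
      {{m*n≢0 (period ψ) (period χ) {{period≢0 ψ}} {{period≢0 χ}}}}
      (λ k → trans (cong (λ t → fun ψ (k + t)) (*-comm (period ψ) (period χ)))
                   (periodic-multiple (fun ψ) (period ψ) (periodic ψ) (period χ) k))
      (periodic-multiple (fun χ) (period χ) (periodic χ) (period ψ)) h
  ... | inj₂ (k , ≢ , h) with <-cmp (fun ψ k) (fun χ k)
  ...   | tri< p _ _ = tri< (k , p , h) (λ e → ≢ (e k))
                         λ q → ≺-irrefl {ψ} {ψ} (λ _ → refl) (≺-trans {ψ} {χ} {ψ} (k , p , h) q)
  ...   | tri≈ _ p _ = contradiction p ≢
  ...   | tri> _ _ p = tri> (λ q → ≺-irrefl {ψ} {ψ} (λ _ → refl) (≺-trans {ψ} {χ} {ψ} q χ≺ψ))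
                         (λ e → ≢ (e k)) χ≺ψ
    where
    χ≺ψ : χ ≺ ψ
    χ≺ψ = k , p , λ l l<k → sym (h l l<k)

  periodicOrder : StrictTotalOrder 0ℓ 0ℓ 0ℓ
  periodicOrder = record
    { Carrier = Periodic ; _≈_ = _≗ᵖ_ ; _<_ = _≺_
    ; isStrictTotalOrder = isStrictTotalOrderᶜ record
      { isEquivalence = record
        { refl  = λ k → refl
        ; sym   = λ e k → sym (e k)
        ; trans = λ e f k → trans (e k) (f k)
        }
      ; trans   = λ {ψ} {χ} {ω} → ≺-trans {ψ} {χ} {ω}
      ; compare = ≺-cmp
      }
    }

  scale : ℕ → ℕ → ℕ
  scale i j = 2 ^ i * 3 ^ j

  scale≢0 : ∀ i j → NonZero (scale i j)
  scale≢0 i j = m*n≢0 (2 ^ i) (3 ^ j) {{m^n≢0 2 i}} {{m^n≢0 3 j}}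

  scale-+ : ∀ i j i′ j′ → scale (i + i′) (j + j′) ≡ scale i′ j′ * scale i j
  scale-+ i j i′ j′ = begin
    2 ^ (i + i′) * 3 ^ (j + j′)
      ≡⟨ cong₂ _*_ (^-distribˡ-+-* 2 i i′) (^-distribˡ-+-* 3 j j′) ⟩
    2 ^ i * 2 ^ i′ * (3 ^ j * 3 ^ j′)
      ≡⟨ solve 4 (λ a b c d → a :* b :* (c :* d) := b :* d :* (a :* c)) refl
           (2 ^ i) (2 ^ i′) (3 ^ j) (3 ^ j′) ⟩
    2 ^ i′ * 3 ^ j′ * (2 ^ i * 3 ^ j)
      ∎
    where
    open ≡-Reasoning
    open +-*-Solver

  -- (i , j , r , ψ) stands for the product X^ψ vʳ pⁱ qʲ, where p v = v² p, q v = v³ q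
  -- and vʳ pⁱ qʲ sends the periodic function ψ to k ↦ ψ ((k + r) / 2ⁱ3ʲ), which is to be
  -- read as 0 when the quotient is not an integer.
  elemOrder : StrictTotalOrder 0ℓ 0ℓ 0ℓ
  elemOrder = ×-strictTotalOrder <-strictTotalOrder
    (×-strictTotalOrder <-strictTotalOrder (×-strictTotalOrder <-strictTotalOrder periodicOrder))

  open StrictTotalOrder elemOrder using () renaming (Carrier to Elem; _≈_ to _≈ᵉ_; _<_ to _<ᵉ_) public

  infixl 7 _·_
  _·_ : Elem → Elem → Elem
  (i , j , r , ψ) · (i′ , j′ , r′ , ψ′) = i + i′ , j + j′ , r + r′ * e , record
    { fun      = λ k → fun ψ k + dilate e (fun ψ′) (k + r)
    ; period   = period ψ * (period ψ′ * e)
    ; period≢0 = m*n≢0 (period ψ) (period ψ′ * e) {{period≢0 ψ}} {{m*n≢0 (period ψ′) e {{period≢0 ψ′}}}}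
    ; periodic = λ k → cong₂ _+_ (per k) (per′ k)
    ; bound    = bound ψ + bound ψ′
    ; bounded  = λ k → +-mono-≤ (bounded ψ k) (dilate-≤ (bounded ψ′) (k + r))
    }
    where
    e = scale i j
    instance e≢0 = scale≢0 i j
    P = period ψ
    P′ = period ψ′
    open ≡-Reasoning
    open +-*-Solver
    per : ∀ k → fun ψ (k + P * (P′ * e)) ≡ fun ψ k
    per k = trans (cong (λ t → fun ψ (k + t)) (*-comm P (P′ * e)))
                  (periodic-multiple (fun ψ) P (periodic ψ) (P′ * e) k)
    per′ : ∀ k → dilate e (fun ψ′) (k + P * (P′ * e) + r) ≡ dilate e (fun ψ′) (k + r)
    per′ k = begin
      dilate e (fun ψ′) (k + P * (P′ * e) + r)
        ≡⟨ cong (dilate e (fun ψ′)) (solve 5 (λ k P P′ e r →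
             k :+ P :* (P′ :* e) :+ r := k :+ r :+ P :* P′ :* e) refl k P P′ e r) ⟩
      dilate e (fun ψ′) (k + r + P * P′ * e)
        ≡⟨ dilate-shift (fun ψ′) (k + r) (P * P′) ⟩
      dilate e (λ l → fun ψ′ (l + P * P′)) (k + r)
        ≡⟨ dilate-cong (periodic-multiple (fun ψ′) P′ (periodic ψ′) P) (k + r) ⟩
      dilate e (fun ψ′) (k + r)
        ∎

  constant0 : Periodic
  constant0 = record
    { fun = λ _ → 0 ; period = 1 ; period≢0 = nonZero ; periodic = λ _ → refl
    ; bound = 0 ; bounded = λ _ → z≤n }

  ·-cong : ∀ {x x′ y y′} → x ≈ᵉ x′ → y ≈ᵉ y′ → x · y ≈ᵉ x′ · y′
  ·-cong {i , j , r , ψ} (refl , refl , refl , h) (refl , refl , refl , h′) =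
    refl , refl , refl , λ k → cong₂ _+_ (h k) (dilate-cong {{scale≢0 i j}} h′ (k + r))

  ·-assoc : ∀ x y z → (x · y) · z ≈ᵉ x · (y · z)
  ·-assoc (i , j , r , ψ) (i′ , j′ , r′ , ψ′) (i″ , j″ , r″ , ψ″) =
    +-assoc i i′ i″ , +-assoc j j′ j″ ,
    (begin
      r + r′ * e + r″ * scale (i + i′) (j + j′)
        ≡⟨ cong (λ t → r + r′ * e + r″ * t) (scale-+ i j i′ j′) ⟩
      r + r′ * e + r″ * (e′ * e)                ≡⟨ solve 5 (λ r r′ r″ e e′ →
        r :+ r′ :* e :+ r″ :* (e′ :* e) := r :+ (r′ :+ r″ :* e′) :* e) refl r r′ r″ e e′ ⟩
      r + (r′ + r″ * e′) * e                    ∎) ,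
    λ k → begin
      fun ψ k + dilate e (fun ψ′) (k + r) + dilate (scale (i + i′) (j + j′)) (fun ψ″) (k + (r + r′ * e))
        ≡⟨ +-assoc (fun ψ k) _ _ ⟩
      fun ψ k + (dilate e (fun ψ′) (k + r) + dilate (scale (i + i′) (j + j′)) (fun ψ″) (k + (r + r′ * e)))
        ≡⟨ cong (λ t → fun ψ k + (dilate e (fun ψ′) (k + r) + t)) (inner k) ⟩
      fun ψ k + (dilate e (fun ψ′) (k + r) + dilate e (λ l → dilate e′ (fun ψ″) (l + r′)) (k + r))
        ≡⟨ cong (fun ψ k +_) (dilate-+ (fun ψ′) _ (k + r)) ⟨
      fun ψ k + dilate e (λ l → fun ψ′ l + dilate e′ (fun ψ″) (l + r′)) (k + r)
        ∎
    where
    e  = scale i j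
    e′ = scale i′ j′
    instance
      e≢0  = scale≢0 i j
      e′≢0 = scale≢0 i′ j′
    open ≡-Reasoning
    open +-*-Solver
    inner : ∀ k → dilate (scale (i + i′) (j + j′)) (fun ψ″) (k + (r + r′ * e)) ≡
                  dilate e (λ l → dilate e′ (fun ψ″) (l + r′)) (k + r)
    inner k = begin
      dilate (scale (i + i′) (j + j′)) (fun ψ″) (k + (r + r′ * e))
        ≡⟨ cong₂ (λ s t → dilate s (fun ψ″) t) (scale-+ i j i′ j′) (sym (+-assoc k r (r′ * e))) ⟩
      dilate (e′ * e) (fun ψ″) (k + r + r′ * e)
        ≡⟨ dilate-dilate (fun ψ″) e′ (k + r + r′ * e) ⟨
      dilate e (dilate e′ (fun ψ″)) (k + r + r′ * e)
        ≡⟨ dilate-shift (dilate e′ (fun ψ″)) (k + r) r′ ⟩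
      dilate e (λ l → dilate e′ (fun ψ″) (l + r′)) (k + r)
        ∎

  unit : Elem
  unit = 0 , 0 , 0 , constant0

  ·-identityˡ : ∀ x → unit · x ≈ᵉ x
  ·-identityˡ (i , j , r , ψ) = refl , refl , *-identityʳ r ,
    λ k → trans (dilate-1 (fun ψ) (k + 0)) (cong (fun ψ) (+-identityʳ k))

  ·-identityʳ : ∀ x → x · unit ≈ᵉ x
  ·-identityʳ (i , j , r , ψ) = +-identityʳ i , +-identityʳ j , +-identityʳ r ,
    λ k → trans (cong (fun ψ k +_) (dilate-0 {{scale≢0 i j}} (k + r))) (+-identityʳ (fun ψ k))

  elemMonoid : Monoid 0ℓ 0ℓ
  elemMonoid = record
    { Carrier = Elem ; _≈_ = _≈ᵉ_ ; _∙_ = _·_ ; ε = unit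
    ; isMonoid = record
      { isSemigroup = record
        { isMagma = record
          { isEquivalence = StrictTotalOrder.isEquivalence elemOrder
          ; ∙-cong = λ {x} {x′} {y} {y′} → ·-cong {x} {x′} {y} {y′}
          }
        ; assoc = ·-assoc
        }
      ; identity = ·-identityˡ , ·-identityʳ
      }
    }

  -- The order of the components matters. What `z` adds to a component of `x` depends only on the
  -- earlier components of `x`, so at the first place where `x` and `y` differ both receive the same
  -- summand.
  ·-monoˡ-< : ∀ {x y} z → x <ᵉ y → x · z <ᵉ y · z
  ·-monoˡ-< {i , j , r , ψ} {i′ , j′ , r′ , ψ′} (i″ , j″ , r″ , ψ″) (inj₁ i<i′) =
    inj₁ (+-monoˡ-< i″ i<i′)
  ·-monoˡ-< (i″ , j″ , r″ , ψ″) (inj₂ (refl , inj₁ j<j′)) =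
    inj₂ (refl , inj₁ (+-monoˡ-< j″ j<j′))
  ·-monoˡ-< {i , j , r , ψ} (i″ , j″ , r″ , ψ″) (inj₂ (refl , inj₂ (refl , inj₁ r<r′))) =
    inj₂ (refl , inj₂ (refl , inj₁ (+-monoˡ-< (r″ * scale i j) r<r′)))
  ·-monoˡ-< (i″ , j″ , r″ , ψ″) (inj₂ (refl , inj₂ (refl , inj₂ (refl , k , ψ<χ , h)))) =
    inj₂ (refl , inj₂ (refl , inj₂ (refl , k , +-monoˡ-< _ ψ<χ , λ l l<k → cong (_+ _) (h l l<k))))

  -- The function k ↦ ψ((k + r″) / e) on ℕ no longer shows ψ l when l e < r″. Adding to l a multiple
  -- of both periods, large enough to pass r″, reads the same value at a visible place `L l`.
  ·-cancelˡ : ∀ {x y} z → z · x ≈ᵉ z · y → x ≈ᵉ y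
  ·-cancelˡ {i , j , r , ψ} {i′ , j′ , r′ , ψ′} (i″ , j″ , r″ , ψ″) (p , p′ , p″ , h) =
    +-cancelˡ-≡ i″ i i′ p , +-cancelˡ-≡ j″ j j′ p′ ,
    *-cancelʳ-≡ r r′ e (+-cancelˡ-≡ r″ (r * e) (r′ * e) p″) , λ l → begin
      fun ψ l                              ≡⟨ far ψ l (period ψ′) ⟨
      fun ψ (l + r″ * (period ψ′ * period ψ))
        ≡⟨ cong (λ t → fun ψ (l + r″ * t)) (*-comm (period ψ′) (period ψ)) ⟩
      fun ψ (L l)                          ≡⟨ dilate-multiple (fun ψ) (L l) ⟨
      dilate e (fun ψ) (L l * e)           ≡⟨ cong (dilate e (fun ψ)) (m∸n+n≡m (r″≤ l)) ⟨
      dilate e (fun ψ) (L l * e ∸ r″ + r″)  ≡⟨ +-cancelˡ-≡ _ _ _ (h (L l * e ∸ r″)) ⟩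
      dilate e (fun ψ′) (L l * e ∸ r″ + r″) ≡⟨ cong (dilate e (fun ψ′)) (m∸n+n≡m (r″≤ l)) ⟩
      dilate e (fun ψ′) (L l * e)          ≡⟨ dilate-multiple (fun ψ′) (L l) ⟩
      fun ψ′ (L l)                         ≡⟨ far ψ′ l (period ψ) ⟩
      fun ψ′ l                             ∎
    where
    e = scale i″ j″
    instance
      e≢0 = scale≢0 i″ j″
      P≢0 = period≢0 ψ
      P′≢0 = period≢0 ψ′
      PP′≢0 : NonZero (period ψ * period ψ′)
      PP′≢0 = m*n≢0 (period ψ) (period ψ′)
    open ≡-Reasoning
    L : ℕ → ℕ
    L l = l + r″ * (period ψ * period ψ′)
    far : ∀ (χ : Periodic) l n → fun χ (l + r″ * (n * period χ)) ≡ fun χ l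
    far χ l n = trans (cong (λ t → fun χ (l + t)) (sym (*-assoc r″ n (period χ))))
      (periodic-multiple (fun χ) (period χ) (periodic χ) (r″ * n) l)
    r″≤ : ∀ l → r″ ≤ L l * e
    r″≤ l = ≤-trans (≤-trans (m≤m*n r″ (period ψ * period ψ′)) (m≤n+m _ l)) (m≤m*n (L l) e)

-- Følner boxes and their growth.

module FølnerBoxes where

  open import Data.Nat using (ℕ; zero; suc; _+_; _*_; _∸_; _^_; _≤_; _<_; s≤s; z≤n; NonZero; nonZero)
  open import Data.Nat.Properties
  open import Data.Nat.DivMod using (_%_; _/_; _mod_; m%n<n; [m+n]%n≡m%n; m<n⇒m%n≡m; m≡m%n+[m/n]*n)
  open import Data.Nat.Divisibility using (_∣_; divides; ∣n⇒∣m*n; *-pres-∣; m∣m*n)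
  open import Data.Nat.Solver using (module +-*-Solver)
  open import Data.Fin using (Fin; zero; suc; toℕ; fromℕ<; combine; remQuot; finToFun; funToFin)
  open import Data.Fin.Properties using (toℕ<n; toℕ-injective; toℕ-fromℕ<; fromℕ<-toℕ; fromℕ<-cong; combine-remQuot; remQuot-combine; finToFun-funToFin)
  open import Data.List using (List; []; _∷_)
  open import Data.List.Relation.Unary.All using (All; []; _∷_)
  import Data.List.Relation.Unary.All as All
  open import Data.Product using (Σ; ∃; ∃₂; _×_; _,_; proj₁; proj₂; map₂; uncurry)
  open import Data.Product.Properties using (,-injectiveˡ; ,-injectiveʳ)
  open import Function using (_∘_; it)
  open import Relation.Binary.PropositionalEquality as ≡ using (_≡_; refl; sym; trans; cong; cong₂; subst; module ≡-Reasoning)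
  open import Data.Sum using (_⊎_; inj₁; inj₂)
  open import Relation.Binary.Bundles using (StrictTotalOrder)
  open import Relation.Binary.Definitions using (tri<; tri≈; tri>)
  open DilationMonoid
  open MonoidRings

  open Periodic

  module EO = StrictTotalOrder elemOrder

  compareᵉ : ∀ x y → x <ᵉ y ⊎ (x ≈ᵉ y ⊎ y <ᵉ x)
  compareᵉ x y with EO.compare x y
  ... | tri< p _ _ = inj₁ p
  ... | tri≈ _ p _ = inj₂ (inj₁ p)
  ... | tri> _ _ p = inj₂ (inj₂ p)

  open MonoidRing elemMonoid public
  open Ordered _<ᵉ_ (λ {x} {y} {z} → EO.trans {x} {y} {z}) compareᵉ (λ {x} {y} → EO.irrefl {x} {y})
    (λ {x} {y} → ·-monoˡ-< {x} {y}) (λ {x} {y} → ·-cancelˡ {x} {y}) public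

  remQuot-injective : ∀ {n} k {i j : Fin (n * k)} → remQuot {n} k i ≡ remQuot k j → i ≡ j
  remQuot-injective {n} k {i} {j} h =
    trans (sym (combine-remQuot {n} k i)) (trans (cong (uncurry combine) h) (combine-remQuot {n} k j))

  toℕ-mod : ∀ {n} .{{_ : NonZero n}} (a : Fin n) → toℕ a mod n ≡ a
  toℕ-mod {n} a = trans (fromℕ<-cong _ _ (m<n⇒m%n≡m (toℕ<n a)) (m%n<n (toℕ a) n) (toℕ<n a)) (fromℕ<-toℕ a (toℕ<n a))

  module Box (D C N B : ℕ) .{{N≢0 : NonZero N}} where

    size : ℕ
    size = D * (D * (C * B ^ N))

    periodise : (Fin N → Fin B) → Periodic
    periodise f = record
      { fun      = λ k → toℕ (f (k mod N))
      ; period   = N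
      ; period≢0 = nz N≢0
      ; periodic = λ k → cong (toℕ ∘ f) (fromℕ<-cong _ _ ([m+n]%n≡m%n k N) _ _)
      ; bound    = B
      ; bounded  = λ k → <⇒≤ (toℕ<n (f (k mod N)))
      }
      where
      nz : ∀ {n} → .(NonZero n) → NonZero n
      nz {suc n} _ = nonZero

    private
      split₂ : Fin (D * (C * B ^ N)) → Fin D × Fin C × Fin (B ^ N)
      split₂ = map₂ (remQuot {C} (B ^ N)) ∘ remQuot {D} (C * B ^ N)

      split : Fin size → Fin D × Fin D × Fin C × Fin (B ^ N)
      split = map₂ split₂ ∘ remQuot {D} (D * (C * B ^ N))

      split-injective : ∀ s t → split s ≡ split t → s ≡ t
      split-injective s t h =
        remQuot-injective {D} _ (cong₂ _,_ (,-injectiveˡ h)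
          (remQuot-injective {D} _ (cong₂ _,_ (,-injectiveˡ (,-injectiveʳ h))
            (remQuot-injective {C} _ (,-injectiveʳ (,-injectiveʳ h))))))

      split-combine : ∀ i j r t → split (combine i (combine j (combine r t))) ≡ (i , j , r , t)
      split-combine i j r t = begin
        split (combine i (combine j (combine r t)))
          ≡⟨ cong (map₂ split₂) (remQuot-combine i (combine j (combine r t))) ⟩
        i , split₂ (combine j (combine r t))
          ≡⟨ cong (λ z → i , map₂ (remQuot {C} (B ^ N)) z) (remQuot-combine j (combine r t)) ⟩
        i , j , remQuot {C} (B ^ N) (combine r t)
          ≡⟨ cong (λ z → i , j , z) (remQuot-combine r t) ⟩
        i , j , r , t                                ∎
        where open ≡-Reasoning

      fill : Fin D × Fin D × Fin C × Fin (B ^ N) → Elem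
      fill (i , j , r , t) = toℕ i , toℕ j , toℕ r , periodise (finToFun t)

    box : Fin size → Elem
    box t = fill (split t)

    box-injective : ∀ s t → box s ≈ᵉ box t → s ≡ t
    box-injective s t (p , p′ , p″ , h) = split-injective s t
      (cong₂ _,_ (toℕ-injective p) (cong₂ _,_ (toℕ-injective p′) (cong₂ _,_ (toℕ-injective p″)
        (finToFun-injective {B} {N} λ a → toℕ-injective
          (subst (λ b → toℕ (finToFun (proj₂ (proj₂ (proj₂ (split s)))) b) ≡ toℕ (finToFun (proj₂ (proj₂ (proj₂ (split t)))) b))
            (toℕ-mod a) (h (toℕ a)))))))

    InBox : Elem → Set
    InBox (i , j , r , ψ) = i < D × j < D × r < C × (∀ k → fun ψ k < B) × (∀ k → fun ψ (k + N) ≡ fun ψ k)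

    box-InBox : ∀ t → InBox (box t)
    box-InBox t = fill-InBox (split t)
      where
      fill-InBox : ∀ z → InBox (fill z)
      fill-InBox (i , j , r , u) = toℕ<n i , toℕ<n j , toℕ<n r ,
        (λ k → toℕ<n (finToFun u (k mod N))) , periodic (periodise (finToFun u))

    box-surjective : ∀ x → InBox x → ∃ λ t → x ≈ᵉ box t
    box-surjective (i , j , r , ψ) (i<D , j<D , r<C , ψ<B , per) =
      combine i′ (combine j′ (combine r′ u)) ,
      subst (λ z → (i , j , r , ψ) ≈ᵉ fill z) (sym (split-combine i′ j′ r′ u))
        (sym (toℕ-fromℕ< i<D) , sym (toℕ-fromℕ< j<D) , sym (toℕ-fromℕ< r<C) , values)
      where
      open ≡-Reasoning
      i′ = fromℕ< i<D
      j′ = fromℕ< j<D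
      r′ = fromℕ< r<C
      f : Fin N → Fin B
      f a = fromℕ< (ψ<B (toℕ a))
      u = funToFin f
      values : ∀ k → fun ψ k ≡ toℕ (finToFun (funToFin f) (k mod N))
      values k = begin
        fun ψ k                              ≡⟨ cong (fun ψ) (m≡m%n+[m/n]*n k N) ⟩
        fun ψ (k % N + (k / N) * N)          ≡⟨ periodic-multiple (fun ψ) N per (k / N) (k % N) ⟩
        fun ψ (k % N)                        ≡⟨ cong (fun ψ) (toℕ-fromℕ< (m%n<n k N)) ⟨
        fun ψ (toℕ (k mod N))                ≡⟨ toℕ-fromℕ< (ψ<B (toℕ (k mod N))) ⟨
        toℕ (f (k mod N))                    ≡⟨ cong toℕ (finToFun-funToFin f (k mod N)) ⟨
        toℕ (finToFun (funToFin f) (k mod N)) ∎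

  record Bounds (X : List Elem) : Set where
    field
      d ρ β Π : ℕ
      Π≢0     : NonZero Π
      within  : All (λ { (i , j , r , ψ) → i ≤ d × j ≤ d × r ≤ ρ × (∀ k → fun ψ k ≤ β) × period ψ ∣ Π }) X

  bounds : ∀ X → Bounds X
  bounds [] = record { d = 0 ; ρ = 0 ; β = 0 ; Π = 1 ; Π≢0 = nonZero ; within = [] }
  bounds ((i , j , r , ψ) ∷ X) = record
    { d = i + j + d ; ρ = r + ρ ; β = bound ψ + β ; Π = period ψ * Π
    ; Π≢0 = m*n≢0 (period ψ) Π {{period≢0 ψ}} {{Π≢0}}
    ; within =
        ( ≤-trans (m≤m+n i j) (m≤m+n (i + j) d) , ≤-trans (m≤n+m j i) (m≤m+n (i + j) d)
        , m≤m+n r ρ , (λ k → ≤-trans (bounded ψ k) (m≤m+n _ β)) , m∣m*n Π )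
        ∷ All.map (λ (p , p′ , p″ , q , h) →
            ≤-trans p (m≤n+m d _) , ≤-trans p′ (m≤n+m d _) , ≤-trans p″ (m≤n+m ρ r) ,
            (λ k → ≤-trans (q k) (m≤n+m β _)) , ∣n⇒∣m*n (period ψ) h) within
    }
    where open Bounds (bounds X)

  -- Bernoulli's inequality (1 - 1/(c+1))^N ≥ 1 - N/(c+1) with the denominators cleared; `M` is c +
  -- 1 - N.
  bernoulli : ∀ N M c → suc c ≡ M + N → suc c ^ N * M ≤ c ^ N * suc c
  bernoulli zero    M c eq = +-monoˡ-≤ 0 (≤-reflexive (trans (sym (+-identityʳ M)) (sym eq)))
  bernoulli (suc N) M c eq = begin
    suc c * suc c ^ N * M
      ≡⟨ solve 3 (λ a b m → a :* b :* m := b :* (a :* m)) refl (suc c) (suc c ^ N) M ⟩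
    suc c ^ N * (suc c * M)  ≤⟨ *-monoʳ-≤ (suc c ^ N) (+-mono-≤ M≤c (≤-reflexive (*-comm c M))) ⟩
    suc c ^ N * (c + M * c)  ≡⟨ *-assoc (suc c ^ N) (suc M) c ⟨
    suc c ^ N * suc M * c    ≤⟨ *-monoˡ-≤ c (bernoulli N (suc M) c (trans eq (+-suc M N))) ⟩
    c ^ N * suc c * c
      ≡⟨ solve 3 (λ a b m → b :* a :* m := m :* b :* a) refl (suc c) (c ^ N) c ⟩
    c * c ^ N * suc c        ∎
    where
    open ≤-Reasoning
    open +-*-Solver
    M≤c : M ≤ c
    M≤c = ≤-pred (≤-trans (s≤s (m≤m+n M N)) (≤-reflexive (trans (sym (+-suc M N)) (sym eq))))

  *-^ : ∀ a b n → (a * b) ^ n ≡ a ^ n * b ^ n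
  *-^ a b zero    = refl
  *-^ a b (suc n) = trans (cong (a * b *_) (*-^ a b n))
    (solve 4 (λ a b c d → a :* b :* (c :* d) := a :* c :* (b :* d)) refl a b (a ^ n) (b ^ n))
    where open +-*-Solver

  -- A side of length 8 d + 1 grows by a factor of at most 9/8 when lengthened by d; the extra 1
  -- keeps it nonzero for d = 0.
  linear-growth : ∀ d → 8 * (suc (8 * d) + d) ≤ 9 * suc (8 * d)
  linear-growth d = begin
    8 * (suc (8 * d) + d)     ≤⟨ n≤1+n _ ⟩
    suc (8 * (suc (8 * d) + d))
      ≡⟨ solve 1 (λ d → con 1 :+ con 8 :* (con 1 :+ con 8 :* d :+ d) := con 9 :* (con 1 :+ con 8 :* d)) refl d ⟩
    9 * suc (8 * d)           ∎
    where
    open ≤-Reasoning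
    open +-*-Solver

  -- Since the growth of the value range is raised to the power `N`, the range must exceed `β` by a
  -- factor proportional to `N`. With B = c (β + 1) the enlarged range is at most (c + 1) (β + 1),
  -- which leaves only c to be chosen.
  power-growth : ∀ β N .{{_ : NonZero N}} → ∃ λ B → NonZero B × 8 * (B + β) ^ N ≤ 9 * B ^ N
  power-growth β (suc n) = c * suc β , nonZero , (begin
    8 * (c * suc β + β) ^ N
      ≤⟨ *-monoʳ-≤ 8 (^-monoˡ-≤ N (≤-trans (+-monoʳ-≤ (c * suc β) (n≤1+n β)) (≤-reflexive (+-comm (c * suc β) (suc β))))) ⟩
    8 * (suc c * suc β) ^ N       ≡⟨ cong (8 *_) (*-^ (suc c) (suc β) N) ⟩
    8 * (suc c ^ N * suc β ^ N)   ≡⟨ *-assoc 8 (suc c ^ N) (suc β ^ N) ⟨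
    8 * suc c ^ N * suc β ^ N     ≤⟨ *-monoˡ-≤ (suc β ^ N) main ⟩
    9 * c ^ N * suc β ^ N         ≡⟨ *-assoc 9 (c ^ N) (suc β ^ N) ⟩
    9 * (c ^ N * suc β ^ N)       ≡⟨ cong (9 *_) (*-^ c (suc β) N) ⟨
    9 * (c * suc β) ^ N           ∎)
    where
    open ≤-Reasoning
    open +-*-Solver
    N = suc n
    -- Then c + 1 = 9 N, and `bernoulli` with M = 8 N gives (c / (c + 1))^N ≥ 8/9.
    c = 8 * N + n
    main : 8 * suc c ^ N ≤ 9 * c ^ N
    main = *-cancelʳ-≤ (8 * suc c ^ N) (9 * c ^ N) N (begin
      8 * suc c ^ N * N
        ≡⟨ solve 2 (λ a b → con 8 :* a :* b := a :* (con 8 :* b)) refl (suc c ^ N) N ⟩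
      suc c ^ N * (8 * N)  ≤⟨ bernoulli N (8 * N) c (sym (+-suc (8 * N) n)) ⟩
      c ^ N * suc c
        ≡⟨ cong (c ^ N *_) (solve 1 (λ n → con 1 :+ (con 8 :* (con 1 :+ n) :+ n) := con 9 :* (con 1 :+ n)) refl n) ⟩
      c ^ N * (9 * N)
        ≡⟨ solve 2 (λ a b → a :* (con 9 :* b) := con 9 :* a :* b) refl (c ^ N) N ⟩
      9 * c ^ N * N        ∎)

  -- (9/8)⁴ < 2
  four-factors : ∀ a b c a′ b′ c′ .{{_ : NonZero a}} .{{_ : NonZero b}} .{{_ : NonZero c}} →
    8 * a′ ≤ 9 * a → 8 * b′ ≤ 9 * b → 8 * c′ ≤ 9 * c →
    a′ * (a′ * (b′ * c′)) < a * (a * (b * c)) + a * (a * (b * c))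
  four-factors a b c a′ b′ c′ ha hb hc = *-cancelˡ-< 4096 _ _ (begin-strict
    4096 * (a′ * (a′ * (b′ * c′)))
      ≡⟨ solve 3 (λ a b c → con 4096 :* (a :* (a :* (b :* c))) := con 8 :* a :* (con 8 :* a :* (con 8 :* b :* (con 8 :* c)))) refl a′ b′ c′ ⟩
    8 * a′ * (8 * a′ * (8 * b′ * (8 * c′)))
      ≤⟨ *-mono-≤ ha (*-mono-≤ ha (*-mono-≤ hb hc)) ⟩
    9 * a * (9 * a * (9 * b * (9 * c)))
      ≡⟨ solve 3 (λ a b c → con 9 :* a :* (con 9 :* a :* (con 9 :* b :* (con 9 :* c))) := con 6561 :* (a :* (a :* (b :* c)))) refl a b c ⟩
    6561 * (a * (a * (b * c)))
      <⟨ *-monoˡ-< (a * (a * (b * c))) {{m*n≢0 a _ {{it}} {{m*n≢0 a _ {{it}} {{m*n≢0 b c}}}}}} (m<m+n 6561 {1631} (s≤s z≤n)) ⟩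
    8192 * (a * (a * (b * c)))
      ≡⟨ solve 1 (λ s → con 8192 :* s := con 4096 :* (s :+ s)) refl (a * (a * (b * c))) ⟩
    4096 * (a * (a * (b * c)) + a * (a * (b * c)))
      ∎)
    where
    open ≤-Reasoning
    open +-*-Solver

  ^-∣ : ∀ a {m n} → m ≤ n → a ^ m ∣ a ^ n
  ^-∣ a {m} {n} m≤n = subst (a ^ m ∣_)
    (trans (sym (^-distribˡ-+-* a m (n ∸ m))) (cong (a ^_) (m+[n∸m]≡n m≤n))) (m∣m*n (a ^ (n ∸ m)))

  module BoxFølner {X : List Elem} (bs : Bounds X) (D C B : ℕ) where
    open Bounds bs

    private
      -- Each scale 2ⁱ 3ʲ with i, j < D divides E = 6^D and is at most E. Hence a product with an
      -- element of X has a function of period N = Π E again, and its translation part has grown by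
      -- at most ρ E.
      E N : ℕ
      E = scale D D
      N = Π * E

      instance
        N≢0 : NonZero N
        N≢0 = m*n≢0 Π E {{Π≢0}} {{scale≢0 D D}}

      module S = Box D C N B
      module T = Box (D + d) (C + ρ * E) N (B + β)

      product-in-box : ∀ x y → S.InBox x →
        proj₁ y ≤ d × proj₁ (proj₂ y) ≤ d × proj₁ (proj₂ (proj₂ y)) ≤ ρ ×
          (∀ k → fun (proj₂ (proj₂ (proj₂ y))) k ≤ β) × period (proj₂ (proj₂ (proj₂ y))) ∣ Π →
        T.InBox (x · y)
      product-in-box (i , j , r , ψ) (i′ , j′ , r′ , ψ′) (i<D , j<D , r<C , ψ<B , per)
                     (i′≤d , j′≤d , r′≤ρ , ψ′≤β , P∣Π) =
        +-mono-<-≤ i<D i′≤d , +-mono-<-≤ j<D j′≤d ,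
        +-mono-<-≤ r<C (*-mono-≤ r′≤ρ (*-mono-≤ (^-monoʳ-≤ 2 (<⇒≤ i<D)) (^-monoʳ-≤ 3 (<⇒≤ j<D)))) ,
        (λ k → +-mono-<-≤ (ψ<B k) (dilate-≤ ψ′≤β (k + r))) ,
        (λ k → cong₂ _+_ (per k) (per′ k))
        where
        e = scale i j
        instance e≢0 = scale≢0 i j
        Pe∣N : period ψ′ * e ∣ N
        Pe∣N = *-pres-∣ P∣Π (*-pres-∣ (^-∣ 2 (<⇒≤ i<D)) (^-∣ 3 (<⇒≤ j<D)))
        open ≡-Reasoning
        open +-*-Solver
        per′ : ∀ k → dilate e (fun ψ′) (k + N + r) ≡ dilate e (fun ψ′) (k + r)
        per′ k with Pe∣N
        ... | divides q eq = begin
          dilate e (fun ψ′) (k + N + r)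
            ≡⟨ cong (λ t → dilate e (fun ψ′) (k + t + r)) eq ⟩
          dilate e (fun ψ′) (k + q * (period ψ′ * e) + r)
            ≡⟨ cong (dilate e (fun ψ′)) (solve 5 (λ k P P′ e r →
                 k :+ P :* (P′ :* e) :+ r := k :+ r :+ P :* P′ :* e) refl k q (period ψ′) e r) ⟩
          dilate e (fun ψ′) (k + r + q * period ψ′ * e)
            ≡⟨ dilate-shift (fun ψ′) (k + r) (q * period ψ′) ⟩
          dilate e (λ l → fun ψ′ (l + q * period ψ′)) (k + r)
            ≡⟨ dilate-cong (periodic-multiple (fun ψ′) (period ψ′) (periodic ψ′) q) (k + r) ⟩
          dilate e (fun ψ′) (k + r)
            ∎

    box-følner : .{{_ : NonZero D}} .{{_ : NonZero C}} .{{_ : NonZero B}} →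
      8 * (D + d) ≤ 9 * D → 8 * (C + ρ * E) ≤ 9 * C → 8 * (B + β) ^ N ≤ 9 * B ^ N →
      ∃₂ λ n m → Σ (Fin n → Elem) λ S → Σ (Fin m → Elem) λ T →
        (m < n + n) × (∀ i j → S i ≈ᵉ S j → i ≡ j) ×
        (∀ i → All (λ x → ∃ λ k → S i · x ≈ᵉ T k) X)
    box-følner hD hC hB = S.size , T.size , S.box , T.box ,
      four-factors D C (B ^ N) (D + d) (C + ρ * E) ((B + β) ^ N) {{it}} {{it}} {{m^n≢0 B N}} hD hC hB ,
      S.box-injective ,
      λ t → All.map (λ {y} h → T.box-surjective (S.box t · y) (product-in-box (S.box t) y (S.box-InBox t) h)) within

  -- `D` is fixed first, since both the increment of the translations and the period of the
  -- functions involve 6^D; the value range comes after the period, on which it depends.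
  følner : Følner
  følner X = box-følner {{nonZero}} {{nonZero}} {{B≢0}}
    (linear-growth d) (linear-growth (ρ * scale D D)) hB
    where
    bs = bounds X
    open Bounds bs
    D = suc (8 * d)
    C = suc (8 * (ρ * scale D D))
    B = power-growth β (Π * scale D D) {{m*n≢0 Π (scale D D) {{Π≢0}} {{scale≢0 D D}}}}
    B≢0 = proj₁ (proj₂ B)
    hB = proj₂ (proj₂ B)
    open BoxFølner bs D C (proj₁ B)

-- The solution in the division ring of fractions.

module DivisionRingSolution where

  open import Algebra.Bundles using (Ring)
  open import Data.Nat using (ℕ; _+_; _*_; nonZero; _≤_; z≤n)
  open import Data.Nat.Properties using (≤-refl; +-mono-≤; +-identityʳ; +-comm; +-assoc)
  open import Data.List using (List; []; _∷_; map; length)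
  open import Data.Nat.ListAction using (sum)
  open import Data.Product using (∃₂; _×_; _,_; proj₁; proj₂)
  open import Relation.Binary.PropositionalEquality as ≡ using (_≡_; refl; sym; trans; cong; cong₂; module ≡-Reasoning)
  open import Relation.Nullary using (¬_; contradiction)
  import Algebra.Properties.Ring as RingProperties
  open import Data.Nat.Solver using (module +-*-Solver)
  open DilationMonoid
  open FølnerBoxes
  open OreLocalisation

  -- Abstract, since conversion checking would otherwise evaluate the pigeonhole search.
  abstract
    ore : ∀ u v → ¬ (v ≃ []) → ∃₂ λ r s → ¬ (r ≃ []) × r ⊗ u ≃ s ⊗ v
    ore = følner⇒ore følner

  open Fractions monoidRing (singleton≄[] unit) integral ore public

  ⟦_⟧ : Elem → List Elem
  ⟦ x ⟧ = x ∷ []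

  _÷_ : Elem → Elem → Fraction
  d ÷ n = frac ⟦ d ⟧ ⟦ n ⟧ (singleton≄[] d)

  ⟦⟧-cong : ∀ {x y} → x ≈ᵉ y → ⟦ x ⟧ ≃ ⟦ y ⟧
  ⟦⟧-cong e = mk≃ λ φ h → cong (_xor false) (h e)
    where open import Data.Bool using (_xor_; false)

  ÷-↦ : ∀ d n c {a b} → a ≈ᵉ c · d → b ≈ᵉ c · n → d ÷ n ∶ ⟦ a ⟧ ↦ ⟦ b ⟧
  ÷-↦ d n c p p′ = ↦-multiple (d ÷ n) ⟦ c ⟧ (⟦⟧-cong p) (⟦⟧-cong p′)

  -- The indicator function of the multiples of 12.
  ι : ℕ → ℕ
  ι = dilate 12 (λ _ → 1)

  ι-+12 : ∀ k → ι (k + 12) ≡ ι k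
  ι-+12 k = dilate-shift (λ _ → 1) k 1

  indicators : List ℕ → ℕ → ℕ
  indicators as k = sum (map (λ a → ι (k + a)) as)

  indicators-periodic : ∀ as k → indicators as (k + 12) ≡ indicators as k
  indicators-periodic []       k = refl
  indicators-periodic (a ∷ as) k = cong₂ _+_ (trans (cong ι rearrange) (ι-+12 (k + a))) (indicators-periodic as k)
    where
    rearrange : k + 12 + a ≡ k + a + 12
    rearrange = trans (+-assoc k 12 a) (trans (cong (k +_) (+-comm 12 a)) (sym (+-assoc k a 12)))

  indicators-bounded : ∀ as k → indicators as k ≤ length as
  indicators-bounded []       k = z≤n
  indicators-bounded (a ∷ as) k = +-mono-≤ (dilate-≤ (λ _ → ≤-refl) (k + a)) (indicators-bounded as k)

  -- g_{a₁} ⋯ g_{aₙ} vʳ pⁱ qʲ, where g_a is the variable attached to the indicator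
  -- function of { k : 12 ∣ k + a }.
  word : List ℕ → ℕ → ℕ → ℕ → Elem
  word as r i j = i , j , r , record
    { fun = indicators as ; period = 12 ; period≢0 = nonZero ; periodic = indicators-periodic as
    ; bound = length as ; bounded = indicators-bounded as }

  v^ : ℕ → Elem
  v^ r = word [] r 0 0

  p gq : Elem
  p  = word [] 0 1 0
  gq = word (0 ∷ []) 0 0 1

  word-·-v : ∀ as r i j s → word as (r + s * scale i j) i j ≈ᵉ word as r i j · v^ s
  word-·-v as r i j s = sym (+-identityʳ i) , sym (+-identityʳ j) , refl , λ k →
    sym (trans (cong (indicators as k +_) (dilate-0 {{scale≢0 i j}} (k + r))) (+-identityʳ _))

  word-·-unit : ∀ as r i j → word as r i j ≈ᵉ word as r i j · unit
  word-·-unit as r i j = EO.Eq.sym {word as r i j · unit} {word as r i j} (·-identityʳ (word as r i j))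

  word-·-p : ∀ as r → word as r 1 0 ≈ᵉ word as r 0 0 · p
  word-·-p as r = refl , refl , sym (+-identityʳ r) , λ k →
    sym (trans (cong (indicators as k +_) (dilate-0 (k + r))) (+-identityʳ _))

  word-·-gq : ∀ as r → word (r ∷ as) r 0 1 ≈ᵉ word as r 0 0 · gq
  word-·-gq as r = refl , refl , sym (+-identityʳ r) , λ k → begin
    ι (k + r) + indicators as k                           ≡⟨ +-comm (ι (k + r)) _ ⟩
    indicators as k + ι (k + r)
      ≡⟨ cong (λ t → indicators as k + ι t) (+-identityʳ (k + r)) ⟨
    indicators as k + ι (k + r + 0)
      ≡⟨ cong (indicators as k +_) (+-identityʳ _) ⟨
    indicators as k + indicators (0 ∷ []) (k + r)
      ≡⟨ cong (indicators as k +_) (dilate-1 (indicators (0 ∷ [])) (k + r)) ⟨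
    indicators as k + dilate 1 (indicators (0 ∷ [])) (k + r) ∎
    where open ≡-Reasoning

  -- y = g p⁻¹ q is written as p⁻¹ (p g p⁻¹) q, where p g p⁻¹ belongs to the multiples of 12
  -- since p dilates the multiples of 6.
  x x′ y y′ : Fraction
  x  = unit ÷ v^ 2
  x′ = v^ 2 ÷ unit
  y  = p ÷ gq
  y′ = gq ÷ p

  -- Carried to the left past pⁱ qʲ, the factor v² has its exponent multiplied by 2ⁱ 3ʲ.
  x-↦ : ∀ as r i j → x ∶ ⟦ word as r i j ⟧ ↦ ⟦ word as (r + 2 * scale i j) i j ⟧
  x-↦ as r i j = ÷-↦ unit (v^ 2) (word as r i j) (word-·-unit as r i j) (word-·-v as r i j 2)

  x′-↦ : ∀ as r i j → x′ ∶ ⟦ word as (r + 2 * scale i j) i j ⟧ ↦ ⟦ word as r i j ⟧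
  x′-↦ as r i j = ÷-↦ (v^ 2) unit (word as r i j) (word-·-v as r i j 2) (word-·-unit as r i j)

  -- At the right end p is traded for q; the inserted indicator travels to the front across vʳ and
  -- is translated by r on the way. Conversely `y′` is evaluated only on words that hold such a
  -- factor to be removed.
  y-↦ : ∀ as r → y ∶ ⟦ word as r 1 0 ⟧ ↦ ⟦ word (r ∷ as) r 0 1 ⟧
  y-↦ as r = ÷-↦ p gq (word as r 0 0) (word-·-p as r) (word-·-gq as r)

  y′-↦ : ∀ as r → y′ ∶ ⟦ word (r ∷ as) r 0 1 ⟧ ↦ ⟦ word as r 1 0 ⟧
  y′-↦ as r = ÷-↦ gq p (word as r 0 0) (word-·-gq as r) (word-·-p as r)

  y′-↦≗ : ∀ bs as r → (∀ k → indicators bs k ≡ indicators (r ∷ as) k) →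
          y′ ∶ ⟦ word bs r 0 1 ⟧ ↦ ⟦ word as r 1 0 ⟧
  y′-↦≗ bs as r h = ↦-resp y′ (⟦⟧-cong (refl , refl , refl , λ k → sym (h k))) ≃-refl (y′-↦ as r)

  xx′≋1 : x ⊛ x′ ≋ embed (Ring.1# monoidRing)
  xx′≋1 = ⊛-inverse x (singleton≄[] (v^ 2))

  yy′≋1 : y ⊛ y′ ≋ embed (Ring.1# monoidRing)
  yy′≋1 = ⊛-inverse y (singleton≄[] gq)

  yx²y′≋x³ : ((y ⊛ x) ⊛ x) ⊛ y′ ≋ (x ⊛ x) ⊛ x
  yx²y′≋x³ = ⟦ word [] 0 1 0 ⟧ , ⟦ word [] 12 1 0 ⟧ , singleton≄[] _ ,
    ↦-⊛ ((y ⊛ x) ⊛ x) y′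
      (↦-⊛ (y ⊛ x) x (↦-⊛ y x (y-↦ [] 0) (x-↦ (0 ∷ []) 0 0 1)) (x-↦ (0 ∷ []) 6 0 1))
      -- The factor created was g₀ and the one to remove is g₁₂; they are equal because `ι` has
      -- period 12.
      (y′-↦≗ (0 ∷ []) [] 12 λ k → cong (_+ 0) (trans (cong ι (+-identityʳ k)) (sym (ι-+12 k)))) ,
    ↦-⊛ (x ⊛ x) x (↦-⊛ x x (x-↦ [] 0 1 0) (x-↦ [] 4 1 0)) (x-↦ [] 8 1 0)

  w : Fraction
  w = ((((((y ⊛ x) ⊛ y′) ⊛ x′) ⊛ y) ⊛ x′) ⊛ y′) ⊛ x

  -- Along `w` the exponent of v runs through 4, 10, 6, 0, 4. The first `y` creates g₄, `y′` removes
  -- g₁₀, the second `y` creates g₆, and `y′` removes g₀. So `start` must contain g₀ and g₁₀, and 4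
  -- is the least exponent for which none becomes negative.
  start finish : Elem
  start  = word (0 ∷ 10 ∷ []) 4 1 0
  finish = word (6 ∷ 4 ∷ []) 4 1 0

  w-↦ : w ∶ ⟦ start ⟧ ↦ ⟦ finish ⟧
  w-↦ =
    ↦-⊛ ((((((y ⊛ x) ⊛ y′) ⊛ x′) ⊛ y) ⊛ x′) ⊛ y′) x
    (↦-⊛ (((((y ⊛ x) ⊛ y′) ⊛ x′) ⊛ y) ⊛ x′) y′
    (↦-⊛ ((((y ⊛ x) ⊛ y′) ⊛ x′) ⊛ y) x′
    (↦-⊛ (((y ⊛ x) ⊛ y′) ⊛ x′) y
    (↦-⊛ ((y ⊛ x) ⊛ y′) x′
    (↦-⊛ (y ⊛ x) y′
    (↦-⊛ y x
      (y-↦ (0 ∷ 10 ∷ []) 4)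
      (x-↦ (4 ∷ 0 ∷ 10 ∷ []) 4 0 1))
      (y′-↦≗ (4 ∷ 0 ∷ 10 ∷ []) (4 ∷ 0 ∷ []) 10 λ k → rotate (ι (k + 4)) (ι (k + 0)) (ι (k + 10))))
      (x′-↦ (4 ∷ 0 ∷ []) 6 1 0))
      (y-↦ (4 ∷ 0 ∷ []) 6))
      (x′-↦ (6 ∷ 4 ∷ 0 ∷ []) 0 0 1))
      (y′-↦≗ (6 ∷ 4 ∷ 0 ∷ []) (6 ∷ 4 ∷ []) 0 λ k → rotate (ι (k + 6)) (ι (k + 4)) (ι (k + 0))))
      (x-↦ (6 ∷ 4 ∷ []) 0 1 0)
    where
    open +-*-Solver
    rotate : ∀ a b c → a + (b + (c + 0)) ≡ c + (a + (b + 0))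
    rotate = solve 3 (λ a b c → a :+ (b :+ (c :+ con 0)) := c :+ (a :+ (b :+ con 0))) refl

  open DivisionRing fractionDivisionRing using () renaming (_-_ to _-ᶠ_; inverse to fraction-inverse)

  w-1≉0 : ¬ (w -ᶠ embed (Ring.1# monoidRing) ≋ embed (Ring.0# monoidRing))
  -- The two functions differ at 0: of 0, 10, 6 and 4 only 0 is a multiple of 12, so `start` takes
  -- the value 1 there and `finish` the value 0.
  w-1≉0 e = contradiction (proj₂ (proj₂ (proj₂ finish≈start)) 0) λ ()
    where
    open RingProperties monoidRing using (+-inverseˡ-unique)
    one = embed (Ring.1# monoidRing)
    finish≈start : finish ≈ᵉ start
    finish≈start = singleton-injective (+-inverseˡ-unique ⟦ finish ⟧ ⟦ start ⟧
      (≋0⇒↦0 (w -ᶠ one) e (↦-⊕ w (⊖ one) w-↦ (↦-⊖ one (↦-1 ⟦ start ⟧)))))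

  fraction-solution : HasDivisionRingSolution fractionDivisionRing
  fraction-solution = x , x′ , y , y′ , proj₁ inv , xx′≋1 , yy′≋1 , yx²y′≋x³ , proj₂ (proj₂ inv)
    where inv = fraction-inverse (w -ᶠ embed (Ring.1# monoidRing)) w-1≉0

-- Consequences of linear dependence in an algebra.

module MatrixAlgebras where

  open import Level using (Level; _⊔_)
  open import Algebra.Bundles using (Ring)
  import Algebra.Properties.Ring as RingProperties
  import Algebra.Properties.Semiring.Exp as SemiringExp
  import Algebra.Properties.Semiring.Sum as SemiringSum
  open import Data.Fin using (Fin; zero; suc)
  open import Data.List using (List; []; _∷_; length; cartesianProduct; allFin)
  open import Data.List.Membership.Propositional using (_∈_)
  open import Data.List.Membership.Propositional.Properties using (∈-cartesianProduct⁺; ∈-allFin)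
  open import Data.List.Relation.Unary.All using (All; []; _∷_)
  import Data.List.Relation.Unary.All as All
  open import Data.List.Relation.Unary.Any using (here; there)
  open import Data.Nat using (ℕ; zero; suc; _≤_; _<_; s≤s)
  import Data.Nat as ℕ
  import Data.Nat.Properties as ℕ
  open import Data.Nat.Solver using (module +-*-Solver)
  open import Data.Product using (∃; _×_; _,_; proj₁; proj₂)
  open import Data.Sum using (_⊎_; inj₁; inj₂)
  open import Function using (_∘_)
  open import Relation.Binary.PropositionalEquality as ≡ using (_≡_)
  import Relation.Binary.Reasoning.Setoid as SetoidReasoning
  open import Relation.Nullary using (¬_; yes; no)
  open import Relation.Nullary.Decidable using (¬¬-excluded-middle)

  module LinearSpan {c ℓ k : Level} (A : Ring c ℓ) {K : Set k}
    (_·_ : K → Ring.Carrier A → Ring.Carrier A) where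

    open Ring A

    record Subspace {p} (Q : Carrier → Set p) : Set (c ⊔ ℓ ⊔ k ⊔ p) where
      field
        null∈    : ∀ {v} → v ≈ 0# → Q v
        combine∈ : ∀ {u v w} a → Q u → Q w → v ≈ u + (a · w) → Q v
    open Subspace public

    -- Combinations are built inductively, without lists of coefficients: a property passes from the
    -- generators to the span as soon as it defines a `Subspace`.
    data Span {p} (P : Carrier → Set p) : Carrier → Set (c ⊔ ℓ ⊔ k ⊔ p) where
      gen     : ∀ {v} → P v → Span P v
      null    : ∀ {v} → v ≈ 0# → Span P v
      combine : ∀ {u v w} a → Span P u → Span P w → v ≈ u + (a · w) → Span P v

    span-minimal : ∀ {p q} {P : Carrier → Set p} {Q : Carrier → Set q} → Subspace Q →
                   (∀ {v} → P v → Q v) → ∀ {v} → Span P v → Q v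
    span-minimal Q-sub h (gen p)           = h p
    span-minimal Q-sub h (null e)          = null∈ Q-sub e
    span-minimal Q-sub h (combine a s t e) =
      combine∈ Q-sub a (span-minimal Q-sub h s) (span-minimal Q-sub h t) e

    span-subspace : ∀ {p} {P : Carrier → Set p} → Subspace (Span P)
    span-subspace = record { null∈ = null ; combine∈ = combine }

    span-mono : ∀ {p q} {P : Carrier → Set p} {Q : Carrier → Set q} →
                (∀ {v} → P v → Q v) → ∀ {v} → Span P v → Span Q v
    span-mono h = span-minimal span-subspace (gen ∘ h)

    -- The form in which finite dimension enters: some term depends on later ones. It is double
    -- negated because finding pivots requires knowing which entries vanish.
    LowestTermDependence : Set (c ⊔ ℓ ⊔ k)
    LowestTermDependence = ∀ (f : ℕ → Carrier) →
      ¬ ¬ (∃ λ i → Span (λ w → ∃ λ j → i < j × w ≡ f j) (f i))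

    module LowestTermDependent
      (·-cong  : ∀ a {u v} → u ≈ v → (a · u) ≈ (a · v))
      (·-*     : ∀ a u v → (a · u) * v ≈ (a · (u * v)))
      (*-·     : ∀ a u v → u * (a · v) ≈ (a · (u * v)))
      (dependence : LowestTermDependence) where

      open SemiringExp semiring using (_^_; ^-congʳ; ^-homo-*)
      open SetoidReasoning setoid

      *-linearˡ : ∀ x {u v w} a → v ≈ u + (a · w) → x * v ≈ x * u + (a · (x * w))
      *-linearˡ x {u} {v} {w} a e = begin
        x * v                  ≈⟨ *-congˡ e ⟩
        x * (u + (a · w))      ≈⟨ distribˡ x u (a · w) ⟩
        x * u + x * (a · w)    ≈⟨ +-congˡ (*-· a x w) ⟩
        x * u + (a · (x * w))  ∎

      *-linearʳ : ∀ x {u v w} a → v ≈ u + (a · w) → v * x ≈ u * x + (a · (w * x))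
      *-linearʳ x {u} {v} {w} a e = begin
        v * x                  ≈⟨ *-congʳ e ⟩
        (u + (a · w)) * x      ≈⟨ distribʳ x u (a · w) ⟩
        u * x + (a · w) * x    ≈⟨ +-congˡ (·-* a w x) ⟩
        u * x + (a · (w * x))  ∎

      ^-comm : ∀ x n → x * x ^ n ≈ x ^ n * x
      ^-comm x n = begin
        x * x ^ n      ≈⟨ ^-congʳ x (ℕ.+-comm 1 n) ⟩
        x ^ (n ℕ.+ 1)  ≈⟨ ^-homo-* x n 1 ⟩
        x ^ n * x ^ 1  ≈⟨ *-congˡ (*-identityʳ x) ⟩
        x ^ n * x      ∎

      module _ {x x′ : Carrier} (xx′≈1 : x * x′ ≈ 1#) where

        *-cancelʳ : ∀ {u v} → u * x ≈ v * x → u ≈ v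
        *-cancelʳ {u} {v} e = begin
          u             ≈⟨ *-identityʳ u ⟨
          u * 1#        ≈⟨ *-congˡ xx′≈1 ⟨
          u * (x * x′)  ≈⟨ *-assoc u x x′ ⟨
          u * x * x′    ≈⟨ *-congʳ e ⟩
          v * x * x′    ≈⟨ *-assoc v x x′ ⟩
          v * (x * x′)  ≈⟨ *-congˡ xx′≈1 ⟩
          v * 1#        ≈⟨ *-identityʳ v ⟩
          v             ∎

        *-cancelʳ-^ : ∀ n {u v} → u * x ^ n ≈ v * x ^ n → u ≈ v
        *-cancelʳ-^ zero    e = trans (sym (*-identityʳ _)) (trans e (*-identityʳ _))
        *-cancelʳ-^ (suc n) e = *-cancelʳ (*-cancelʳ-^ n (trans (*-assoc _ x _) (trans e (sym (*-assoc _ x _)))))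

        ^-cancelˡ : ∀ i v → x ^ i * (x′ ^ i * v) ≈ v
        ^-cancelˡ zero    v = trans (*-identityˡ _) (*-identityˡ v)
        ^-cancelˡ (suc i) v = begin
          x * x ^ i * (x′ * x′ ^ i * v)    ≈⟨ *-cong (^-comm x i) (*-assoc x′ (x′ ^ i) v) ⟩
          x ^ i * x * (x′ * (x′ ^ i * v))  ≈⟨ *-assoc (x ^ i) x _ ⟩
          x ^ i * (x * (x′ * (x′ ^ i * v))) ≈⟨ *-congˡ (*-assoc x x′ _) ⟨
          x ^ i * (x * x′ * (x′ ^ i * v))  ≈⟨ *-congˡ (*-congʳ xx′≈1) ⟩
          x ^ i * (1# * (x′ ^ i * v))      ≈⟨ *-congˡ (*-identityˡ _) ⟩
          x ^ i * (x′ ^ i * v)             ≈⟨ ^-cancelˡ i v ⟩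
          v                                ∎

        -- A linear relation among the powers of x′ can be divided by its lowest term x′ⁱ
        -- and then exhibits a right inverse of x′.
        right-inverse⇒left-inverse : ¬ ¬ (x′ * x ≈ 1#)
        right-inverse⇒left-inverse k = dependence (x′ ^_) λ (i , s) →
          k (left-inverse i (span-minimal (divisible i) (λ { (j , i<j , ≡.refl) → powers i j i<j }) s))
          where
          Divisible : ℕ → Carrier → Set (c ⊔ ℓ)
          Divisible i v = ∃ λ t → x ^ i * v ≈ x′ * t

          divisible : ∀ i → Subspace (Divisible i)
          divisible i = record
            { null∈    = λ e → 0# , trans (*-congˡ e) (trans (zeroʳ _) (sym (zeroʳ x′)))
            ; combine∈ = λ a (t , p) (s , q) e → t + (a · s) ,
                trans (*-linearˡ (x ^ i) a e) (trans (+-cong p (·-cong a q)) (sym (*-linearˡ x′ a refl)))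
            }

          powers : ∀ i j → i < j → Divisible i (x′ ^ j)
          powers i j i<j with ℕ.m≤n⇒∃[o]m+o≡n i<j
          ... | o , ≡.refl = x′ ^ o , (begin
            x ^ i * x′ ^ (suc i ℕ.+ o)      ≈⟨ *-congˡ (^-congʳ x′ (ℕ.+-suc i o)) ⟨
            x ^ i * x′ ^ (i ℕ.+ suc o)      ≈⟨ *-congˡ (^-homo-* x′ i (suc o)) ⟩
            x ^ i * (x′ ^ i * x′ ^ suc o)   ≈⟨ ^-cancelˡ i (x′ ^ suc o) ⟩
            x′ * x′ ^ o                     ∎)

          left-inverse : ∀ i → Divisible i (x′ ^ i) → x′ * x ≈ 1#
          left-inverse i (t , e) = trans (*-congˡ x≈t) (sym 1≈x′t)
            where
            1≈x′t : 1# ≈ x′ * t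
            1≈x′t = begin
              1#                     ≈⟨ ^-cancelˡ i 1# ⟨
              x ^ i * (x′ ^ i * 1#)  ≈⟨ *-congˡ (*-identityʳ (x′ ^ i)) ⟩
              x ^ i * x′ ^ i         ≈⟨ e ⟩
              x′ * t                 ∎
            x≈t : x ≈ t
            x≈t = begin
              x             ≈⟨ *-identityʳ x ⟨
              x * 1#        ≈⟨ *-congˡ 1≈x′t ⟩
              x * (x′ * t)  ≈⟨ *-assoc x x′ t ⟨
              x * x′ * t    ≈⟨ *-congʳ xx′≈1 ⟩
              1# * t        ≈⟨ *-identityˡ t ⟩
              t             ∎

      module _ {x x′ y y′ : Carrier} (xx′≈1 : x * x′ ≈ 1#) (yy′≈1 : y * y′ ≈ 1#) (y′y≈1 : y′ * y ≈ 1#)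
        (yx²y′≈x³ : y * x * x * y′ ≈ x * x * x) where

        conj-* : ∀ u v → (y * u * y′) * (y * v * y′) ≈ y * (u * v) * y′
        conj-* u v = begin
          (y * u * y′) * (y * v * y′)    ≈⟨ *-assoc (y * u) y′ _ ⟩
          y * u * (y′ * (y * v * y′))    ≈⟨ *-congˡ (*-assoc y′ (y * v) y′) ⟨
          y * u * (y′ * (y * v) * y′)    ≈⟨ *-congˡ (*-congʳ (*-assoc y′ y v)) ⟨
          y * u * (y′ * y * v * y′)
            ≈⟨ *-congˡ (*-congʳ (trans (*-congʳ y′y≈1) (*-identityˡ v))) ⟩
          y * u * (v * y′)               ≈⟨ *-assoc (y * u) v y′ ⟨
          y * u * v * y′                 ≈⟨ *-congʳ (*-assoc y u v) ⟩
          y * (u * v) * y′               ∎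

        conj-x² : y * x ^ 2 * y′ ≈ x ^ 3
        conj-x² = begin
          y * (x * (x * 1#)) * y′  ≈⟨ *-congʳ (*-congˡ (*-congˡ (*-identityʳ x))) ⟩
          y * (x * x) * y′         ≈⟨ *-congʳ (*-assoc y x x) ⟨
          y * x * x * y′           ≈⟨ yx²y′≈x³ ⟩
          x * x * x                ≈⟨ *-assoc x x x ⟩
          x * (x * x)              ≈⟨ *-congˡ (*-congˡ (*-identityʳ x)) ⟨
          x * (x * (x * 1#))       ∎

        -- Induction on k absorbs one x³ at a time into the conjugate as x². The bystander `u` is 1
        -- in `conj-x^2k` and x where an odd power of x is conjugated.
        *-conj-x^2k : ∀ u k → (y * u * y′) * x ^ (3 ℕ.* k) ≈ y * (u * x ^ (2 ℕ.* k)) * y′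
        *-conj-x^2k u zero    = trans (*-identityʳ _) (*-congʳ (*-congˡ (sym (*-identityʳ u))))
        *-conj-x^2k u (suc k) = begin
          (y * u * y′) * x ^ (3 ℕ.* suc k)                ≈⟨ *-congˡ (^-congʳ x (ℕ.*-suc 3 k)) ⟩
          (y * u * y′) * x ^ (3 ℕ.+ 3 ℕ.* k)              ≈⟨ *-congˡ (^-homo-* x 3 (3 ℕ.* k)) ⟩
          (y * u * y′) * (x ^ 3 * x ^ (3 ℕ.* k))          ≈⟨ *-assoc _ _ _ ⟨
          (y * u * y′) * x ^ 3 * x ^ (3 ℕ.* k)            ≈⟨ *-congʳ (*-congˡ conj-x²) ⟨
          (y * u * y′) * (y * x ^ 2 * y′) * x ^ (3 ℕ.* k) ≈⟨ *-congʳ (conj-* u (x ^ 2)) ⟩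
          (y * (u * x ^ 2) * y′) * x ^ (3 ℕ.* k)          ≈⟨ *-conj-x^2k (u * x ^ 2) k ⟩
          y * (u * x ^ 2 * x ^ (2 ℕ.* k)) * y′            ≈⟨ *-congʳ (*-congˡ (*-assoc _ _ _)) ⟩
          y * (u * (x ^ 2 * x ^ (2 ℕ.* k))) * y′
            ≈⟨ *-congʳ (*-congˡ (*-congˡ (^-homo-* x 2 (2 ℕ.* k)))) ⟨
          y * (u * x ^ (2 ℕ.+ 2 ℕ.* k)) * y′
            ≈⟨ *-congʳ (*-congˡ (*-congˡ (^-congʳ x (ℕ.*-suc 2 k)))) ⟨
          y * (u * x ^ (2 ℕ.* suc k)) * y′                ∎

        conj-x^2k : ∀ k → y * x ^ (2 ℕ.* k) * y′ ≈ x ^ (3 ℕ.* k)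
        conj-x^2k k = begin
          y * x ^ (2 ℕ.* k) * y′         ≈⟨ *-congʳ (*-congˡ (*-identityˡ _)) ⟨
          y * (1# * x ^ (2 ℕ.* k)) * y′  ≈⟨ *-conj-x^2k 1# k ⟨
          (y * 1# * y′) * x ^ (3 ℕ.* k)  ≈⟨ *-congʳ (trans (*-congʳ (*-identityʳ y)) yy′≈1) ⟩
          1# * x ^ (3 ℕ.* k)             ≈⟨ *-identityˡ _ ⟩
          x ^ (3 ℕ.* k)                  ∎

        Commutes : ℕ → Carrier → Set ℓ
        Commutes zero    v = v * x ≈ x * v
        Commutes (suc m) v = Commutes m (y * v * y′)

        commutes-resp : ∀ m {u v} → u ≈ v → Commutes m u → Commutes m v
        commutes-resp zero    e p = trans (*-congʳ (sym e)) (trans p (*-congˡ e))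
        commutes-resp (suc m) e p = commutes-resp m (*-congʳ (*-congˡ e)) p

        commutes-subspace : ∀ m → Subspace (Commutes m)
        commutes-subspace zero = record
          { null∈    = λ e → trans (trans (*-congʳ e) (zeroˡ x)) (sym (trans (*-congˡ e) (zeroʳ x)))
          ; combine∈ = λ a p q e →
              trans (*-linearʳ x a e) (trans (+-cong p (·-cong a q)) (sym (*-linearˡ x a e)))
          }
        commutes-subspace (suc m) = record
          { null∈    = λ e → null∈ (commutes-subspace m)
              (trans (*-congʳ (trans (*-congˡ e) (zeroʳ y))) (zeroˡ y′))
          ; combine∈ = λ a p q e → combine∈ (commutes-subspace m) a p q (*-linearʳ y′ a (*-linearˡ y a e))
          }

        conj-x^2^[1+m]k : ∀ m k → y * x ^ (2 ℕ.^ suc m ℕ.* k) * y′ ≈ x ^ (2 ℕ.^ m ℕ.* (3 ℕ.* k))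
        conj-x^2^[1+m]k m k = begin
          y * x ^ (2 ℕ.^ suc m ℕ.* k) * y′
            ≈⟨ *-congʳ (*-congˡ (^-congʳ x (ℕ.*-assoc 2 (2 ℕ.^ m) k))) ⟩
          y * x ^ (2 ℕ.* (2 ℕ.^ m ℕ.* k)) * y′  ≈⟨ conj-x^2k (2 ℕ.^ m ℕ.* k) ⟩
          x ^ (3 ℕ.* (2 ℕ.^ m ℕ.* k))
            ≈⟨ ^-congʳ x (solve 2 (λ a k → con 3 :* (a :* k) := a :* (con 3 :* k)) ≡.refl (2 ℕ.^ m) k) ⟩
          x ^ (2 ℕ.^ m ℕ.* (3 ℕ.* k))           ∎
          where open +-*-Solver

        -- Every conjugation trades a factor 2 of the exponent for a factor 3, so after m of them
        -- the result is still a power of x.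
        powers-commute : ∀ m k → Commutes m (x ^ (2 ℕ.^ m ℕ.* k))
        powers-commute zero    k = sym (^-comm x (1 ℕ.* k))
        powers-commute (suc m) k =
          commutes-resp m (sym (conj-x^2^[1+m]k m k)) (powers-commute m (3 ℕ.* k))

        -- Of the m + 1 conjugations, m are spent on turning 2^m into 3^m in the exponent, and one
        -- is left.
        conj-power-commutes : ∀ m k → Commutes (suc m) (x ^ (2 ℕ.^ m ℕ.* k)) →
                              Commutes 1 (x ^ (3 ℕ.^ m ℕ.* k))
        conj-power-commutes zero    k p = p
        conj-power-commutes (suc m) k p = commutes-resp 1
          (^-congʳ x (solve 2 (λ a k → a :* (con 3 :* k) := con 3 :* a :* k) ≡.refl (3 ℕ.^ m) k))
          (conj-power-commutes m (3 ℕ.* k) (commutes-resp (suc m) (conj-x^2^[1+m]k m k) p))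
          where open +-*-Solver

        3^-odd : ∀ i → ∃ λ q → 3 ℕ.^ i ℕ.* 1 ≡ suc (2 ℕ.* q)
        3^-odd zero    = 0 , ≡.refl
        3^-odd (suc i) with 3^-odd i
        ... | q , eq = suc (3 ℕ.* q) , ≡.trans (ℕ.*-assoc 3 (3 ℕ.^ i) 1) (≡.trans (≡.cong (3 ℕ.*_) eq)
          (solve 1 (λ q → con 3 :* (con 1 :+ con 2 :* q) := con 1 :+ con 2 :* (con 1 :+ con 3 :* q)) ≡.refl q))
          where open +-*-Solver

        -- The powers x^(2ʲ) are dependent, so some x^(2ⁱ) is a combination of the x^(2ʲ)
        -- with j > i.  Conjugating i + 1 times by y turns the latter into powers of x and the
        -- former into y x^(3ⁱ) y⁻¹, which is y x y⁻¹ times a power of x since 3ⁱ is odd.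
        conj-x-commutes : ¬ ¬ Commutes 1 x
        conj-x-commutes k = dependence (λ j → x ^ (2 ℕ.^ j ℕ.* 1)) λ (i , s) →
          k (conclude i (conj-power-commutes i 1 (span-minimal (commutes-subspace (suc i)) (higher i) s)))
          where
          higher : ∀ i {w} → (∃ λ j → i < j × w ≡ x ^ (2 ℕ.^ j ℕ.* 1)) → Commutes (suc i) w
          higher i (j , i<j , ≡.refl) with ℕ.m≤n⇒∃[o]m+o≡n i<j
          ... | o , ≡.refl = commutes-resp (suc i)
            (^-congʳ x (≡.sym (≡.trans (ℕ.*-identityʳ _) (ℕ.^-distribˡ-+-* 2 (suc i) o))))
            (powers-commute (suc i) (2 ℕ.^ o))

          conclude : ∀ i → Commutes 1 (x ^ (3 ℕ.^ i ℕ.* 1)) → Commutes 1 x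
          conclude i p with 3^-odd i
          ... | q , eq = *-cancelʳ-^ xx′≈1 n (begin
            u * x * x ^ n                    ≈⟨ *-assoc u x _ ⟩
            u * (x * x ^ n)                  ≈⟨ *-congˡ (^-comm x n) ⟩
            u * (x ^ n * x)                  ≈⟨ *-assoc u _ x ⟨
            u * x ^ n * x                    ≈⟨ commutes-resp 0
              (trans (*-congʳ (*-congˡ (^-congʳ x eq))) (sym (*-conj-x^2k x q))) p ⟩
            x * (u * x ^ n)                  ≈⟨ *-assoc x u _ ⟨
            x * u * x ^ n                    ∎)
            where
            u = y * x * y′
            n = 3 ℕ.* q

      -- With u = y x y′ the factor y x′ y′ is the inverse of u, so the word is u x′ u⁻¹ x, a
      -- commutator of commuting elements.
      commutator≈1 : ∀ {x x′ y y′} → x * x′ ≈ 1# → x′ * x ≈ 1# → y * y′ ≈ 1# → y′ * y ≈ 1# →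
        (y * x * y′) * x ≈ x * (y * x * y′) → y * x * y′ * x′ * y * x′ * y′ * x ≈ 1#
      commutator≈1 {x} {x′} {y} {y′} xx′≈1 x′x≈1 yy′≈1 y′y≈1 ux≈xu = begin
        u * x′ * y * x′ * y′ * x         ≈⟨ *-congʳ (*-congʳ (*-congʳ (*-congʳ ux′≈x′u))) ⟩
        x′ * u * y * x′ * y′ * x         ≈⟨ *-congʳ (*-congʳ (*-congʳ (*-assoc x′ u y))) ⟩
        x′ * (u * y) * x′ * y′ * x       ≈⟨ *-congʳ (*-congʳ (*-congʳ (*-congˡ uy≈yx))) ⟩
        x′ * (y * x) * x′ * y′ * x       ≈⟨ *-congʳ (*-congʳ (*-assoc x′ (y * x) x′)) ⟩
        x′ * (y * x * x′) * y′ * x       ≈⟨ *-congʳ (*-congʳ (*-congˡ (cancelˡʳ y xx′≈1))) ⟩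
        x′ * y * y′ * x                  ≈⟨ *-congʳ (cancelˡʳ x′ yy′≈1) ⟩
        x′ * x                           ≈⟨ x′x≈1 ⟩
        1#                               ∎
        where
        u = y * x * y′
        cancelˡʳ : ∀ a {b b′} → b * b′ ≈ 1# → a * b * b′ ≈ a
        cancelˡʳ a e = trans (*-assoc a _ _) (trans (*-congˡ e) (*-identityʳ a))
        uy≈yx : u * y ≈ y * x
        uy≈yx = cancelˡʳ (y * x) y′y≈1
        ux′≈x′u : u * x′ ≈ x′ * u
        ux′≈x′u = *-cancelʳ xx′≈1 (begin
          u * x′ * x    ≈⟨ cancelˡʳ u x′x≈1 ⟩
          u             ≈⟨ *-identityˡ u ⟨
          1# * u        ≈⟨ *-congʳ x′x≈1 ⟨
          x′ * x * u    ≈⟨ *-assoc x′ x u ⟩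
          x′ * (x * u)  ≈⟨ *-congˡ ux≈xu ⟨
          x′ * (u * x)  ≈⟨ *-assoc x′ u x ⟨
          x′ * u * x    ∎)

      solution⇒trivial : HasSolution _≈_ _*_ _-_ 1# → ¬ ¬ (1# ≈ 0#)
      solution⇒trivial (x , x′ , y , y′ , z , xx′≈1 , yy′≈1 , yx²y′≈x³ , z[w-1]≈1) k =
        right-inverse⇒left-inverse xx′≈1 λ x′x≈1 →
        right-inverse⇒left-inverse yy′≈1 λ y′y≈1 →
        conj-x-commutes xx′≈1 yy′≈1 y′y≈1 yx²y′≈x³ λ ux≈xu → k (begin
          1#             ≈⟨ z[w-1]≈1 ⟨
          z * (_ - 1#)   ≈⟨ *-congˡ (x≈y⇒x∙y⁻¹≈ε (commutator≈1 xx′≈1 x′x≈1 yy′≈1 y′y≈1 ux≈xu)) ⟩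
          z * 0#         ≈⟨ zeroʳ z ⟩
          0#             ∎)
        where open RingProperties A using (x≈y⇒x∙y⁻¹≈ε)

  -- The algebra of square matrices over a field.

  module MatrixRing {c ℓ : Level} (F : Field c ℓ) where

    open Field F hiding (zero)
    open Matrices F
    open SemiringSum semiring using (sum; ∑-distrib-+; *-distribˡ-sum; *-distribʳ-sum)
    open SetoidReasoning setoid

    Σᶠ≡sum : ∀ n (f : Fin n → Carrier) → Σᶠ f ≡ sum f
    Σᶠ≡sum zero    f = ≡.refl
    Σᶠ≡sum (suc n) f = ≡.cong (f zero +_) (Σᶠ≡sum n (f ∘ suc))

    Σᶠ-cong : ∀ n {f g : Fin n → Carrier} → (∀ i → f i ≈ g i) → Σᶠ f ≈ Σᶠ g
    Σᶠ-cong zero    h = refl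
    Σᶠ-cong (suc n) h = +-cong (h zero) (Σᶠ-cong n (h ∘ suc))

    Σᶠ-0 : ∀ n {f : Fin n → Carrier} → (∀ i → f i ≈ 0#) → Σᶠ f ≈ 0#
    Σᶠ-0 zero    h = refl
    Σᶠ-0 (suc n) h = trans (+-cong (h zero) (Σᶠ-0 n (h ∘ suc))) (+-identityˡ 0#)

    Σᶠ-+ : ∀ n (f g : Fin n → Carrier) → Σᶠ (λ i → f i + g i) ≈ Σᶠ f + Σᶠ g
    Σᶠ-+ n f g rewrite Σᶠ≡sum n f | Σᶠ≡sum n g | Σᶠ≡sum n (λ i → f i + g i) = ∑-distrib-+ f g

    Σᶠ-*ˡ : ∀ n x (f : Fin n → Carrier) → x * Σᶠ f ≈ Σᶠ (λ i → x * f i)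
    Σᶠ-*ˡ n x f rewrite Σᶠ≡sum n f | Σᶠ≡sum n (λ i → x * f i) = *-distribˡ-sum x f

    Σᶠ-*ʳ : ∀ n x (f : Fin n → Carrier) → Σᶠ f * x ≈ Σᶠ (λ i → f i * x)
    Σᶠ-*ʳ n x f rewrite Σᶠ≡sum n f | Σᶠ≡sum n (λ i → f i * x) = *-distribʳ-sum x f

    Σᶠ-swap : ∀ m n (f : Fin m → Fin n → Carrier) →
              Σᶠ (λ i → Σᶠ (λ j → f i j)) ≈ Σᶠ (λ j → Σᶠ (λ i → f i j))
    Σᶠ-swap zero    n f = sym (Σᶠ-0 n λ _ → refl)
    Σᶠ-swap (suc m) n f = trans (+-congˡ (Σᶠ-swap m n (f ∘ suc))) (sym (Σᶠ-+ n (f zero) _))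

    Σᶠ-δˡ : ∀ {n} i (f : Fin n → Carrier) → Σᶠ (λ k → δ i k * f k) ≈ f i
    Σᶠ-δˡ {suc n} zero    f = trans (+-cong (*-identityˡ _) (Σᶠ-0 n λ k → zeroˡ _)) (+-identityʳ _)
    Σᶠ-δˡ {suc n} (suc i) f = trans (+-cong (zeroˡ _) (Σᶠ-δˡ i (f ∘ suc))) (+-identityˡ _)

    Σᶠ-δʳ : ∀ {n} i (f : Fin n → Carrier) → Σᶠ (λ k → f k * δ k i) ≈ f i
    Σᶠ-δʳ {suc n} zero    f = trans (+-cong (*-identityʳ _) (Σᶠ-0 n λ k → zeroʳ _)) (+-identityʳ _)
    Σᶠ-δʳ {suc n} (suc i) f = trans (+-cong (zeroʳ _) (Σᶠ-δʳ i (f ∘ suc))) (+-identityˡ _)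

    infixl 6 _+ᴹ_
    _+ᴹ_ : ∀ {n} → Mat n → Mat n → Mat n
    (A +ᴹ B) i j = A i j + B i j

    infixr 7 _·ᴹ_
    _·ᴹ_ : ∀ {n} → Carrier → Mat n → Mat n
    (a ·ᴹ A) i j = a * A i j

    *ᴹ-cong : ∀ {n} {A A′ B B′ : Mat n} → A ≈ᴹ A′ → B ≈ᴹ B′ → (A *ᴹ B) ≈ᴹ (A′ *ᴹ B′)
    *ᴹ-cong {n} h h′ i j = Σᶠ-cong n λ k → *-cong (h i k) (h′ k j)

    *ᴹ-assoc : ∀ {n} (A B C : Mat n) → ((A *ᴹ B) *ᴹ C) ≈ᴹ (A *ᴹ (B *ᴹ C))
    *ᴹ-assoc {n} A B C i j = begin
      Σᶠ (λ k → Σᶠ (λ l → A i l * B l k) * C k j)    ≈⟨ Σᶠ-cong n (λ k → Σᶠ-*ʳ n (C k j) _) ⟩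
      Σᶠ (λ k → Σᶠ (λ l → A i l * B l k * C k j))    ≈⟨ Σᶠ-swap n n _ ⟩
      Σᶠ (λ l → Σᶠ (λ k → A i l * B l k * C k j))
        ≈⟨ Σᶠ-cong n (λ l → Σᶠ-cong n λ k → *-assoc _ _ _) ⟩
      Σᶠ (λ l → Σᶠ (λ k → A i l * (B l k * C k j)))  ≈⟨ Σᶠ-cong n (λ l → Σᶠ-*ˡ n (A i l) _) ⟨
      Σᶠ (λ l → A i l * Σᶠ (λ k → B l k * C k j))    ∎

    matrixRing : ℕ → Ring c ℓ
    matrixRing n = record
      { Carrier = Mat n ; _≈_ = _≈ᴹ_ ; _+_ = _+ᴹ_ ; _*_ = _*ᴹ_ ; -_ = λ A i j → - A i j
      ; 0# = λ _ _ → 0# ; 1# = 1ᴹ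
      ; isRing = record
        { +-isAbelianGroup = record
          { isGroup = record
            { isMonoid = record
              { isSemigroup = record
                { isMagma = record
                  { isEquivalence = record
                    { refl  = λ i j → refl
                    ; sym   = λ h i j → sym (h i j)
                    ; trans = λ h h′ i j → trans (h i j) (h′ i j)
                    }
                  ; ∙-cong = λ h h′ i j → +-cong (h i j) (h′ i j)
                  }
                ; assoc = λ A B C i j → +-assoc _ _ _
                }
              ; identity = (λ A i j → +-identityˡ _) , (λ A i j → +-identityʳ _)
              }
            ; inverse = (λ A i j → -‿inverseˡ _) , (λ A i j → -‿inverseʳ _)
            ; ⁻¹-cong = λ h i j → -‿cong (h i j)
            }
          ; comm = λ A B i j → +-comm _ _
          }
        ; *-cong     = *ᴹ-cong
        ; *-assoc    = *ᴹ-assoc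
        ; *-identity = (λ A i j → Σᶠ-δˡ i (λ k → A k j)) , (λ A i j → Σᶠ-δʳ j (A i))
        ; distrib    =
            (λ A B C i j → trans (Σᶠ-cong n λ k → distribˡ _ _ _) (Σᶠ-+ n (λ k → A i k * B k j) (λ k → A i k * C k j))) ,
            (λ A B C i j → trans (Σᶠ-cong n λ k → distribʳ _ _ _) (Σᶠ-+ n (λ k → B i k * A k j) (λ k → C i k * A k j)))
        }
      }

    ·ᴹ-*ᴹ : ∀ {n} a (A B : Mat n) → ((a ·ᴹ A) *ᴹ B) ≈ᴹ (a ·ᴹ (A *ᴹ B))
    ·ᴹ-*ᴹ {n} a A B i j = trans (Σᶠ-cong n λ k → *-assoc _ _ _) (sym (Σᶠ-*ˡ n a _))

    *ᴹ-·ᴹ : ∀ {n} a (A B : Mat n) → (A *ᴹ (a ·ᴹ B)) ≈ᴹ (a ·ᴹ (A *ᴹ B))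
    *ᴹ-·ᴹ {n} a A B i j = trans (Σᶠ-cong n λ k → trans (sym (*-assoc _ _ _))
      (trans (*-congʳ (*-comm _ _)) (*-assoc _ _ _))) (sym (Σᶠ-*ˡ n a _))

  -- Elimination and dependent sequences of matrices.

  module MatrixAlgebra {c ℓ : Level} (F : Field c ℓ) (n : ℕ) where

    open Field F hiding (zero)
    open Matrices F
    open MatrixRing F
    open LinearSpan (matrixRing n) _·ᴹ_
    open SetoidReasoning setoid

    entry-subspace : ∀ (i j : Fin n) → Subspace (λ v → v i j ≈ 0#)
    entry-subspace i j = record
      { null∈    = λ e → e i j
      ; combine∈ = λ a p q e → trans (e i j)
          (trans (+-cong p (trans (*-congˡ q) (zeroʳ a))) (+-identityˡ 0#))
      }

    -- The order of the list matters: an entry has to depend on its successors, as the lowest term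
    -- of a relation does.
    data Dependent : List (Mat n) → Set (c ⊔ ℓ) where
      here  : ∀ {v vs} → Span (_∈ vs) v → Dependent (v ∷ vs)
      there : ∀ {v vs} → Dependent vs → Dependent (v ∷ vs)

    module _ (i j : Fin n) where

      record Eliminated (vs : List (Mat n)) : Set (c ⊔ ℓ) where
        field
          rest        : List (Mat n)
          shorter     : length vs ≡ suc (length rest)
          vanish      : All (λ v → v i j ≈ 0#) rest
          dependent   : Dependent rest → Dependent vs
          span        : ∀ {u} → Span (_∈ rest) u → Span (_∈ vs) u
          pivot       : Mat n
          pivot∈span  : Span (_∈ vs) pivot
          pivot≉0     : ¬ (pivot i j ≈ 0#)

      -- Working from the tail makes the pivot the last matrix whose entry is nonzero. A correction
      -- of an earlier `v` then stays within the span of the successors of `v`, and dependences on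
      -- later entries survive.
      eliminate : ∀ vs → ¬ ¬ (All (λ v → v i j ≈ 0#) vs ⊎ Eliminated vs)
      eliminate []       k = k (inj₁ [])
      eliminate (v ∷ vs) k = eliminate vs λ
        { (inj₁ zeros) → ¬¬-excluded-middle λ
            { (yes v≈0) → k (inj₁ (v≈0 ∷ zeros))
            ; (no  v≉0) → k (inj₂ record
                { rest = vs ; shorter = ≡.refl ; vanish = zeros ; dependent = there
                ; span = span-mono there ; pivot = v ; pivot∈span = gen (here ≡.refl) ; pivot≉0 = v≉0 })
            }
        ; (inj₂ el) → k (inj₂ (step el))
        }
        where
        step : Eliminated vs → Eliminated (v ∷ vs)
        step el = record
          { rest = v′ ∷ rest ; shorter = ≡.cong suc shorter ; vanish = v′≈0 ∷ vanish
          ; dependent = λ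
              { (here s)  → here (combine a (span s) pivot∈span v≈)
              ; (there d) → there (dependent d)
              }
          ; span = span-minimal span-subspace λ
              { (here ≡.refl) → combine (- a) (gen (here ≡.refl)) (span-mono there pivot∈span) λ i j → refl
              ; (there w∈)    → span-mono there (span (gen w∈))
              }
          ; pivot = pivot ; pivot∈span = span-mono there pivot∈span ; pivot≉0 = pivot≉0
          }
          where
          open Eliminated el
          pivot⁻¹ : Carrier
          pivot⁻¹ = proj₁ (inverse (pivot i j) pivot≉0)
          a : Carrier
          a = v i j * pivot⁻¹
          v′ : Mat n
          v′ = v +ᴹ (- a) ·ᴹ pivot
          open RingProperties ring using (-‿distribˡ-*)
          v≈ : v ≈ᴹ (v′ +ᴹ a ·ᴹ pivot)
          v≈ i j = begin
            v i j                                          ≈⟨ +-identityʳ _ ⟨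
            v i j + 0#                                     ≈⟨ +-congˡ (zeroˡ _) ⟨
            v i j + 0# * pivot i j                         ≈⟨ +-congˡ (*-congʳ (-‿inverseˡ a)) ⟨
            v i j + (- a + a) * pivot i j                  ≈⟨ +-congˡ (distribʳ _ _ _) ⟩
            v i j + (- a * pivot i j + a * pivot i j)      ≈⟨ +-assoc _ _ _ ⟨
            v i j + - a * pivot i j + a * pivot i j        ∎
          v′≈0 : v′ i j ≈ 0#
          v′≈0 = begin
            v i j + - a * pivot i j                       ≈⟨ +-congˡ (-‿distribˡ-* a _) ⟨
            v i j + - (v i j * pivot⁻¹ * pivot i j)       ≈⟨ +-congˡ (-‿cong (*-assoc _ _ _)) ⟩
            v i j + - (v i j * (pivot⁻¹ * pivot i j))
              ≈⟨ +-congˡ (-‿cong (*-congˡ (proj₂ (proj₂ (inverse (pivot i j) pivot≉0))))) ⟩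
            v i j + - (v i j * 1#)                        ≈⟨ +-congˡ (-‿cong (*-identityʳ _)) ⟩
            v i j + - v i j                               ≈⟨ -‿inverseʳ _ ⟩
            0#                                            ∎

    -- By `separated` the positions in `ks` are coordinates on the span. Each round uses up one
    -- position and one matrix: the pivot, or the head if that entry vanishes throughout. When no
    -- position is left, every remaining matrix is zero.
    dependent-if-long : ∀ (ks : List (Fin n × Fin n)) vs → length ks < length vs →
      (∀ {u} → Span (_∈ vs) u → All (λ (i , j) → u i j ≈ 0#) ks → u ≈ᴹ (λ _ _ → 0#)) →
      ¬ ¬ Dependent vs
    dependent-if-long []             (v ∷ vs) _ separated k = k (here (null (separated (gen (here ≡.refl)) [])))
    dependent-if-long ((i , j) ∷ ks) (v ∷ vs) (s≤s ks<vs) separated k = eliminate i j (v ∷ vs) λ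
      { (inj₁ (_ ∷ zeros)) → dependent-if-long ks vs ks<vs
          (λ s h → separated (span-mono there s) (span-minimal (entry-subspace i j) (All.lookup zeros) s ∷ h))
          (k ∘ there)
      ; (inj₂ el) → let open Eliminated el in
          dependent-if-long ks rest (≡.subst (length ks <_) (ℕ.suc-injective shorter) ks<vs)
            (λ s h → separated (span s) (span-minimal (entry-subspace i j) (All.lookup vanish) s ∷ h))
            (k ∘ dependent)
      }

    module _ (f : ℕ → Mat n) where

      private
        segment : ℕ → ℕ → List (Mat n)
        segment s zero    = []
        segment s (suc m) = f s ∷ segment (suc s) m

        length-segment : ∀ s m → length (segment s m) ≡ m
        length-segment s zero    = ≡.refl
        length-segment s (suc m) = ≡.cong suc (length-segment (suc s) m)

        segment-∈ : ∀ s m {w} → w ∈ segment s m → ∃ λ j → s ≤ j × w ≡ f j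
        segment-∈ s (suc m) (here ≡.refl) = s , ℕ.≤-refl , ≡.refl
        segment-∈ s (suc m) (there w∈) with segment-∈ (suc s) m w∈
        ... | j , s<j , eq = j , ℕ.<⇒≤ s<j , eq

        dependent-segment : ∀ s m → Dependent (segment s m) →
                            ∃ λ i → Span (λ w → ∃ λ j → i < j × w ≡ f j) (f i)
        dependent-segment s (suc m) (here sp)  = s , span-mono (segment-∈ (suc s) m) sp
        dependent-segment s (suc m) (there d) = dependent-segment (suc s) m d

      sequence-dependent : ¬ ¬ (∃ λ i → Span (λ w → ∃ λ j → i < j × w ≡ f j) (f i))
      -- One more term than the n² positions.
      sequence-dependent k = dependent-if-long ks (segment 0 (suc (length ks)))
        (ℕ.≤-reflexive (≡.sym (length-segment 0 (suc (length ks)))))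
        (λ _ h i j → All.lookup h (∈-cartesianProduct⁺ (∈-allFin i) (∈-allFin j)))
        (k ∘ dependent-segment 0 (suc (length ks)))
        where ks = cartesianProduct (allFin n) (allFin n)

    open LowestTermDependent (λ a h i j → *-congˡ (h i j)) ·ᴹ-*ᴹ *ᴹ-·ᴹ sequence-dependent public

  no-matrix-solution : ∀ {c ℓ} (F : Field c ℓ) k → ¬ HasMatrixSolution F (suc k)
  no-matrix-solution F k solution =
    MatrixAlgebra.solution⇒trivial F (suc k) solution λ 1≈0 → Field.1≉0 F (1≈0 zero zero)

theorem6p5 : ∀ {c ℓ : Level} →
    Σ (DivisionRing 0ℓ 0ℓ) HasDivisionRingSolution
    × ((F : Field c ℓ) (k : ℕ) → ¬ HasMatrixSolution F (suc k))
theorem6p5 =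
  (DivisionRingSolution.fractionDivisionRing , DivisionRingSolution.fraction-solution) ,
  MatrixAlgebras.no-matrix-solution
  where open import Data.Product using (_,_)
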